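{- Let $[Q]$ be a toric poset on a vertex set $V=[n]$, and let $G$ be the underlying undirected graph of $[Q]$. If either $G$ is disconnected and has at least three vertices, or $G$ has a cut vertex, then $\Psi_{\rm tor}^{[Q]}(\mathbf{x})=0$ as a rational function.
   Context: All quivers are finite directed graphs that are simple (no loops, no parallel or anti-parallel arcs) and acyclic (no directed cycles), on a vertex set $V=[n]=\{1,\dots,n\}$. A source is a vertex all of whose incident arcs point away from it; a sink is a vertex all of whose incident arcs point into it (an isolated vertex is both). A flip at a source or sink $k$ reverses all arcs incident to $k$. Two acyclic quivers are equivalent if they are related by a finite sequence of flips; the equivalence class $[Q]$ of $Q$ is called a toric poset. All members of $[Q]$ have the same underlying undirected graph, called the underlying graph of $[Q]$. A cut vertex of a graph is a vertex whose removal increases the number of connected components. A toric total order $[w]=[(w_1,\dots,w_n)]$ is the equivalence class of a permutation $(w_1,\dots,w_n)$ of $V$ under cyclic rotation $(w_1,\dots,w_n)\mapsto(w_2,\dots,w_n,w_1)$. For a graph $G$ on $V$, let $\mathcal{A}_{\rm tor}(G)$ be the image in $\mathbb{R}^n/\mathbb{Z}^n$ of $\bigcup_{\{i,j\}\in G}\{x_i=x_j\}\subset\mathbb{R}^n$. A point of $\mathbb{R}^n/\mathbb{Z}^n-\mathcal{A}_{\rm tor}(G)$ determines an acyclic orientation of $G$: $i\to j$ if $x_i \bmod 1< x_j \bmod 1$ (values in $[0,1)$), and $j\to i$ otherwise. For a toric poset $[Q]$ with underlying graph $G$, its toric chamber $c_{[Q]}$ is the set of points whose orientation lies in $[Q]$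 (these sets are exactly the connected components of $\mathbb{R}^n/\mathbb{Z}^n-\mathcal{A}_{\rm tor}(G)$). For a toric total order $[w]$, $c_{[w]}$ is the set of points with pairwise distinct coordinates such that listing the indices in increasing order of $x_i\bmod 1$ gives a member of $[w]$. $[w]$ is a toric total extension of $[Q]$ if $c_{[w]}\subseteq c_{[Q]}$; the set of these is $\mathcal{L}_{\rm tor}([Q])$. Define $\Psi_{\rm tor}^{[Q]}(\mathbf{x})=\sum_{[w]\in\mathcal{L}_{\rm tor}([Q])}\Psi_{\rm tor}^{[w]}(\mathbf{x})$, where $\Psi_{\rm tor}^{[w]}(\mathbf{x})=\dfrac{1}{(x_{w_1}-x_{w_2})(x_{w_2}-x_{w_3})\cdots(x_{w_{n-1}}-x_{w_n})(x_{w_n}-x_{w_1})}$ and $\mathbf{x}=(x_1,\dots,x_n)$ are indeterminates. -}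

module Defs where

open import Level using (0ℓ; _⊔_) renaming (suc to lsuc)
open import Algebra.Bundles using (CommutativeRing)
import Algebra.Properties.Ring as RingProperties
import Algebra.Solver.Ring.NaturalCoefficients.Default as SemiringSolver
open import Data.Bool.Base using (_∨_; if_then_else_)
open import Data.Fin.Base using (Fin; zero; suc)
import Data.Fin.Properties as Fin
open import Data.Integer.Base using (ℤ)
open import Data.List.Base using (List; []; _∷_; map; foldr; length; allFin; _∷ʳ_; cartesianProductWith)
open import Data.List.Membership.Propositional using (_∈_)
open import Data.List.Membership.Propositional.Properties using (∈-allFin; ∈-cartesianProductWith⁺)
open import Data.List.Properties using (length-tabulate)
open import Data.List.Relation.Binary.Permutation.Propositional using (_↭_)
open import Data.List.Relation.Binary.Permutation.Propositional.Properties using (↭-length)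
open import Data.List.Relation.Unary.All using (All; []; _∷_)
open import Data.List.Relation.Unary.All.Properties using (¬Any⇒All¬)
open import Data.List.Relation.Unary.AllPairs using (AllPairs; []; _∷_)
open import Data.List.Relation.Unary.Any using (Any; here; there)
open import Data.List.Relation.Unary.Linked using (Linked)
open import Data.Nat.Base using (ℕ; zero; suc)
import Data.Nat.Base as ℕ
open import Data.Product.Base using (∃; ∃₂; _×_; _,_; proj₁; proj₂; Σ-syntax)
open import Data.Rational.Base using (ℚ; 0ℚ; 1ℚ)
import Data.Rational.Base as ℚ
import Data.Rational.Properties as ℚ
open import Data.Sum.Base using (_⊎_; inj₁; inj₂; [_,_]′)
open import Function.Base using (id; _∘_)
open import Function.Bundles using (_⇔_; mk⇔)
open import Relation.Binary.Core using (Rel)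
open import Relation.Binary.Definitions using (Decidable; Reflexive)
open import Relation.Binary.Construct.Closure.ReflexiveTransitive using (Star; ε)
open import Relation.Binary.Construct.Closure.Transitive using (TransClosure)
open import Relation.Binary.PropositionalEquality as ≡ using (_≡_; _≢_)
import Relation.Binary.Reasoning.Setoid as SetoidReasoning
open import Relation.Nullary using (¬_; Dec; yes; no; does; contradiction)
open import Relation.Nullary.Decidable using (¬¬-excluded-middle)
open import Relation.Nullary.Negation using (¬¬-map)
open import Relation.Unary using (Pred; U; _⊆_)

-- The finite set of _∼_-classes of elements satisfying P, enumerated by
-- listing exactly one representative of each class.

record Transversal {a p ℓ} {A : Set a} (P : Pred A p) (_∼_ : Rel A ℓ)
                   : Set (a ⊔ p ⊔ ℓ) where
  field
    representatives : List A
    sound    : All P representatives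
    distinct : AllPairs (λ x y → ¬ (x ∼ y)) representatives
    complete : ∀ {x} → P x → Any (x ∼_) representatives

  size : ℕ
  size = length representatives

open Transversal public

¬¬-transversal : ∀ {a p ℓ} {A : Set a} {P : Pred A p} {_∼_ : Rel A ℓ} →
                 Reflexive _∼_ → (xs : List A) → (∀ {x} → P x → x ∈ xs) →
                 ¬ ¬ Transversal P _∼_
¬¬-transversal {A = A} {P} {_∼_} ∼-refl xs P⊆xs =
  ¬¬-map (λ (ys , s , d , c) → record
    { representatives = ys ; sound = s ; distinct = d ; complete = λ p → c (P⊆xs p) p })
    (select xs)
  where
  Selection : List A → Set _
  Selection xs = ∃ λ ys → All P ys × AllPairs (λ x y → ¬ (x ∼ y)) ys ×
                          (∀ {x} → x ∈ xs → P x → Any (x ∼_) ys)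

  skip : ∀ {x xs} ((ys , _) : Selection xs) → (P x → Any (x ∼_) ys) → Selection (x ∷ xs)
  skip (ys , s , d , c) x∼ys = ys , s , d , λ where
    (here ≡.refl) → x∼ys
    (there x∈xs)  → c x∈xs

  keep : ∀ {x xs} ((ys , _) : Selection xs) → P x → ¬ Any (x ∼_) ys → Selection (x ∷ xs)
  keep {x} (ys , s , d , c) p x≁ys =
    x ∷ ys , p ∷ s , ¬Any⇒All¬ ys x≁ys ∷ d , λ where
      (here ≡.refl) _ → here ∼-refl
      (there x∈xs)  q → there (c x∈xs q)

  select : ∀ xs → ¬ ¬ Selection xs
  select []       k = k ([] , [] , [] , λ ())
  select (x ∷ xs) k = select xs λ sel →
    ¬¬-excluded-middle λ where
      (yes x∼ys) → k (skip sel λ _ → x∼ys)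
      (no  x≁ys) → ¬¬-excluded-middle λ where
        (yes p) → k (keep sel p x≁ys)
        (no ¬p) → k (skip sel λ p → contradiction p ¬p)

module _ {n : ℕ} (E : Rel (Fin n) 0ℓ) where

  Connected : Set
  Connected = ∀ i j → Star E i j

  Induced : Pred (Fin n) 0ℓ → Rel (Fin n) 0ℓ
  Induced S i j = S i × S j × E i j

  Components : Pred (Fin n) 0ℓ → Set
  Components S = Transversal S (Star (Induced S))

  IsCutVertex : Fin n → Set
  IsCutVertex v = Σ[ C ∈ Components U ] Σ[ C′ ∈ Components (_≢ v) ] size C ℕ.< size C′

-- Acyclicity includes the absence of loops and of anti-parallel arcs.
record Quiver (n : ℕ) : Set₁ where
  field
    Arc     : Rel (Fin n) 0ℓ
    arc?    : Decidable Arc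
    acyclic : ∀ i → ¬ TransClosure Arc i i

  Edge : Rel (Fin n) 0ℓ
  Edge i j = Arc i j ⊎ Arc j i

  IsSource IsSink : Pred (Fin n) 0ℓ
  IsSource k = ∀ j → ¬ Arc j k
  IsSink   k = ∀ j → ¬ Arc k j

  FlippedArc : Fin n → Rel (Fin n) 0ℓ
  FlippedArc k i j =
    if does (i Fin.≟ k) ∨ does (j Fin.≟ k) then Arc j i else Arc i j

open Quiver public

module _ {n : ℕ} where

  Flip : Quiver n → Fin n → Quiver n → Set
  Flip Q k Q′ = (IsSource Q k ⊎ IsSink Q k) × (∀ i j → Arc Q′ i j ⇔ FlippedArc Q k i j)

  infix 4 _∼_

  -- The toric poset [Q] is the class of Q. The inverse of a flip is a flip,
  -- so composing flips in one direction is enough.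
  data _∼_ : Quiver n → Quiver n → Set₁ where
    done : ∀ {Q Q′} → (∀ i j → Arc Q i j ⇔ Arc Q′ i j) → Q ∼ Q′
    flip : ∀ {Q Q′ Q″} k → Flip Q k Q′ → Q′ ∼ Q″ → Q ∼ Q″

record ℝ : Set₁ where
  field
    Lower Upper     : Pred ℚ 0ℓ
    lower-inhabited : ∃ Lower
    upper-inhabited : ∃ Upper
    lower-rounded   : ∀ q → Lower q ⇔ (∃ λ r → q ℚ.< r × Lower r)
    upper-rounded   : ∀ q → Upper q ⇔ (∃ λ r → r ℚ.< q × Upper r)
    disjoint        : ∀ q → ¬ (Lower q × Upper q)
    located         : ∀ q r → q ℚ.< r → Lower q ⊎ Upper r

open ℝ public

fromℚ : ℚ → ℝ
fromℚ x = record
  { Lower           = ℚ._< x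
  ; Upper           = x ℚ.<_
  ; lower-inhabited = x ℚ.- 1ℚ , ≡.subst (x ℚ.- 1ℚ ℚ.<_) (ℚ.+-identityʳ x)
                                   (ℚ.+-monoʳ-< x (ℚ.negative⁻¹ (ℚ.- 1ℚ)))
  ; upper-inhabited = x ℚ.+ 1ℚ , ≡.subst (ℚ._< x ℚ.+ 1ℚ) (ℚ.+-identityʳ x)
                                   (ℚ.+-monoʳ-< x (ℚ.positive⁻¹ 1ℚ))
  ; lower-rounded   = λ q → mk⇔ (λ q<x → let r , q<r , r<x = ℚ.<-dense q<x in r , q<r , r<x)
                                (λ (r , q<r , r<x) → ℚ.<-trans q<r r<x)
  ; upper-rounded   = λ q → mk⇔ (λ x<q → let r , x<r , r<q = ℚ.<-dense x<q in r , r<q , x<r)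
                                (λ (r , r<q , x<r) → ℚ.<-trans x<r r<q)
  ; disjoint        = λ q (q<x , x<q) → ℚ.<-asym q<x x<q
  ; located         = locate
  }
  where
  locate : ∀ q r → q ℚ.< r → q ℚ.< x ⊎ x ℚ.< r
  locate q r q<r with q ℚ.<? x
  ... | yes q<x = inj₁ q<x
  ... | no  q≮x = inj₂ (ℚ.≤-<-trans (ℚ.≮⇒≥ q≮x) q<r)

infix 4 _<ᴿ_ _≤ᴿ_ _≈ᴿ_ _≡ℤ_

_<ᴿ_ _≤ᴿ_ _≈ᴿ_ _≡ℤ_ : Rel ℝ 0ℓ
x <ᴿ y = ∃ λ q → Upper x q × Lower y q
x ≤ᴿ y = ¬ (y <ᴿ x)
x ≈ᴿ y = ∀ q → Lower x q ⇔ Lower y q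

-- x - y is an integer k: the lower cut of x is that of y shifted by k.
x ≡ℤ y = ∃ λ (k : ℤ) → ∀ q → Lower x (q ℚ.+ k ℚ./ 1) ⇔ Lower y q

-- Points of ℝⁿ/ℤⁿ are given by representatives in ℝⁿ.
Point : ℕ → Set₁
Point n = Fin n → ℝ

-- x mod 1 is a relation because the integer part of a real number is not
-- computable.
record _mod1≡_ (x r : ℝ) : Set where
  field
    0≤r : fromℚ 0ℚ ≤ᴿ r
    r<1 : r <ᴿ fromℚ 1ℚ
    x≡r : x ≡ℤ r

module _ {n : ℕ} where

  _HasResidues_ : Rel (Point n) 0ℓ
  x HasResidues r = ∀ i → x i mod1≡ r i

  𝒜-tor : Rel (Fin n) 0ℓ → Pred (Point n) (lsuc 0ℓ)
  𝒜-tor E x = ∃ λ (y : Point n) → (∀ i → x i ≡ℤ y i) × (∃₂ λ i j → E i j × y i ≈ᴿ y j)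

  chamber : Quiver n → Pred (Point n) (lsuc 0ℓ)
  chamber Q x = ¬ 𝒜-tor (Edge Q) x ×
    (∃ λ r → x HasResidues r ×
      (∃ λ Q′ → Q ∼ Q′ × (∀ i j → Arc Q′ i j ⇔ (Edge Q i j × r i <ᴿ r j))))

  rotate : List (Fin n) → List (Fin n)
  rotate []       = []
  rotate (i ∷ is) = is ∷ʳ i

  infix 4 _↻_

  _↻_ : Rel (List (Fin n)) 0ℓ
  _↻_ = Star (λ w w′ → w′ ≡ rotate w)

  IsTotalOrder : Pred (List (Fin n)) 0ℓ
  IsTotalOrder w = w ↭ allFin n

  -- When w lists all vertices, the strict inequalities already force the
  -- coordinates of x to be pairwise distinct modulo 1.
  orderChamber : List (Fin n) → Pred (Point n) (lsuc 0ℓ)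
  orderChamber w x =
    ∃ λ r → x HasResidues r × (∃ λ w′ → w ↻ w′ × Linked (λ i j → r i <ᴿ r j) w′)

  IsToricTotalExtension : Quiver n → Pred (List (Fin n)) (lsuc 0ℓ)
  IsToricTotalExtension Q w = IsTotalOrder w × orderChamber w ⊆ chamber Q

  ℒ-tor : Quiver n → Set₁
  ℒ-tor Q = Transversal (IsToricTotalExtension Q) _↻_

  private
    words : ℕ → List (List (Fin n))
    words zero    = [] ∷ []
    words (suc k) = cartesianProductWith _∷_ (allFin n) (words k)

    ∈-words : ∀ w → w ∈ words (length w)
    ∈-words []       = here ≡.refl
    ∈-words (i ∷ is) = ∈-cartesianProductWith⁺ _∷_ (∈-allFin i) (∈-words is)

  -- Deciding which orders are extensions is not needed for a statement about
  -- every enumeration; classically one exists.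
  ℒ-tor-exists : ∀ Q → ¬ ¬ ℒ-tor Q
  ℒ-tor-exists Q = ¬¬-transversal ε (words n) λ {w} (w↭V , _) →
    ≡.subst (λ k → w ∈ words k) (≡.trans (↭-length w↭V) (length-tabulate {n = n} id)) (∈-words w)

record IntegralDomain : Set₁ where
  field
    commutativeRing : CommutativeRing 0ℓ 0ℓ
  open CommutativeRing commutativeRing public
  field
    1≉0      : ¬ (1# ≈ 0#)
    integral : ∀ x y → x * y ≈ 0# → x ≈ 0# ⊎ y ≈ 0#
    _≟0      : ∀ x → Dec (x ≈ 0#)

module Polynomial (D : IntegralDomain) where
  open IntegralDomain D hiding (zero)
  open RingProperties ring using (-0#≈0#)
  open SetoidReasoning setoid

  -- A polynomial in one variable is its list of coefficients, constant term
  -- first; trailing zeros are not significant.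
  Poly : Set
  Poly = List Carrier

  coeff : Poly → ℕ → Carrier
  coeff []      _       = 0#
  coeff (a ∷ _) zero    = a
  coeff (_ ∷ p) (suc k) = coeff p k

  infix  4 _≋_
  infixl 6 _⊕_
  infixl 7 _⊛_ _·_

  record _≋_ (p q : Poly) : Set where
    constructor coeffwise
    field coeff-≈ : ∀ k → coeff p k ≈ coeff q k
  open _≋_

  _⊕_ : Poly → Poly → Poly
  []      ⊕ q       = q
  (a ∷ p) ⊕ []      = a ∷ p
  (a ∷ p) ⊕ (b ∷ q) = a + b ∷ p ⊕ q

  ⊖_ : Poly → Poly
  ⊖_ = map (-_)

  _·_ : Carrier → Poly → Poly
  a · p = map (a *_) p

  _⊛_ : Poly → Poly → Poly
  []      ⊛ q = []
  (a ∷ p) ⊛ q = a · q ⊕ (0# ∷ p ⊛ q)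

  const : Carrier → Poly
  const a = a ∷ []

  X : Poly
  X = 0# ∷ 1# ∷ []

  private
    ≋-refl : ∀ {p} → p ≋ p
    ≋-refl = coeffwise λ _ → refl

    ≋-sym : ∀ {p q} → p ≋ q → q ≋ p
    ≋-sym e = coeffwise λ k → sym (coeff-≈ e k)

    ≋-trans : ∀ {p q r} → p ≋ q → q ≋ r → p ≋ r
    ≋-trans e f = coeffwise λ k → trans (coeff-≈ e k) (coeff-≈ f k)

    ∷-cong : ∀ {a b p q} → a ≈ b → p ≋ q → a ∷ p ≋ b ∷ q
    ∷-cong a≈b p≋q = coeffwise λ where
      zero    → a≈b
      (suc k) → coeff-≈ p≋q k

    ∷-head : ∀ {a b p q} → a ∷ p ≋ b ∷ q → a ≈ b
    ∷-head e = coeff-≈ e zero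

    ∷-tail : ∀ {a b p q} → a ∷ p ≋ b ∷ q → p ≋ q
    ∷-tail e = coeffwise (coeff-≈ e ∘ suc)

    0∷[] : 0# ∷ [] ≋ []
    0∷[] = coeffwise λ where
      zero    → refl
      (suc _) → refl

    ∷≋[] : ∀ {a p} → a ≈ 0# → p ≋ [] → a ∷ p ≋ []
    ∷≋[] a≈0 p≋0 = ≋-trans (∷-cong a≈0 p≋0) 0∷[]

    ∷≋[]-head : ∀ {a p} → a ∷ p ≋ [] → a ≈ 0#
    ∷≋[]-head e = coeff-≈ e zero

    ∷≋[]-tail : ∀ {a p} → a ∷ p ≋ [] → p ≋ []
    ∷≋[]-tail e = coeffwise (coeff-≈ e ∘ suc)

    coeff-⊕ : ∀ p q k → coeff (p ⊕ q) k ≈ coeff p k + coeff q k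
    coeff-⊕ []      q       k       = sym (+-identityˡ _)
    coeff-⊕ (a ∷ p) []      k       = sym (+-identityʳ _)
    coeff-⊕ (a ∷ p) (b ∷ q) zero    = refl
    coeff-⊕ (a ∷ p) (b ∷ q) (suc k) = coeff-⊕ p q k

    coeff-· : ∀ a p k → coeff (a · p) k ≈ a * coeff p k
    coeff-· a []      k       = sym (zeroʳ a)
    coeff-· a (b ∷ p) zero    = refl
    coeff-· a (b ∷ p) (suc k) = coeff-· a p k

    coeff-⊖ : ∀ p k → coeff (⊖ p) k ≈ - coeff p k
    coeff-⊖ []      k       = sym -0#≈0#
    coeff-⊖ (a ∷ p) zero    = refl
    coeff-⊖ (a ∷ p) (suc k) = coeff-⊖ p k

    ⊕-cong : ∀ {p p′ q q′} → p ≋ p′ → q ≋ q′ → p ⊕ q ≋ p′ ⊕ q′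
    ⊕-cong {p} {p′} {q} {q′} e f = coeffwise λ k → begin
      coeff (p ⊕ q) k         ≈⟨ coeff-⊕ p q k ⟩
      coeff p k + coeff q k   ≈⟨ +-cong (coeff-≈ e k) (coeff-≈ f k) ⟩
      coeff p′ k + coeff q′ k ≈⟨ coeff-⊕ p′ q′ k ⟨
      coeff (p′ ⊕ q′) k       ∎

    ⊕-assoc : ∀ p q r → (p ⊕ q) ⊕ r ≋ p ⊕ (q ⊕ r)
    ⊕-assoc p q r = coeffwise λ k → begin
      coeff ((p ⊕ q) ⊕ r) k               ≈⟨ coeff-⊕ (p ⊕ q) r k ⟩
      coeff (p ⊕ q) k + coeff r k         ≈⟨ +-congʳ (coeff-⊕ p q k) ⟩
      coeff p k + coeff q k + coeff r k   ≈⟨ +-assoc _ _ _ ⟩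
      coeff p k + (coeff q k + coeff r k) ≈⟨ +-congˡ (coeff-⊕ q r k) ⟨
      coeff p k + coeff (q ⊕ r) k         ≈⟨ coeff-⊕ p (q ⊕ r) k ⟨
      coeff (p ⊕ (q ⊕ r)) k               ∎

    ⊕-comm : ∀ p q → p ⊕ q ≋ q ⊕ p
    ⊕-comm p q = coeffwise λ k → begin
      coeff (p ⊕ q) k       ≈⟨ coeff-⊕ p q k ⟩
      coeff p k + coeff q k ≈⟨ +-comm _ _ ⟩
      coeff q k + coeff p k ≈⟨ coeff-⊕ q p k ⟨
      coeff (q ⊕ p) k       ∎

    ⊕-identityʳ : ∀ p → p ⊕ [] ≋ p
    ⊕-identityʳ []      = ≋-refl
    ⊕-identityʳ (_ ∷ _) = ≋-refl

    ⊕-interchange : ∀ p q r s → (p ⊕ q) ⊕ (r ⊕ s) ≋ (p ⊕ r) ⊕ (q ⊕ s)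
    ⊕-interchange p q r s =
      ≋-trans (⊕-assoc p q (r ⊕ s))
      (≋-trans (⊕-cong {p} {p} ≋-refl
                 (≋-trans (≋-sym (⊕-assoc q r s))
                 (≋-trans (⊕-cong {q = s} (⊕-comm q r) ≋-refl) (⊕-assoc r q s))))
               (≋-sym (⊕-assoc p r (q ⊕ s))))

    ⊖-cong : ∀ {p q} → p ≋ q → ⊖ p ≋ ⊖ q
    ⊖-cong {p} {q} e = coeffwise λ k →
      trans (coeff-⊖ p k) (trans (-‿cong (coeff-≈ e k)) (sym (coeff-⊖ q k)))

    ⊖-inverseˡ : ∀ p → ⊖ p ⊕ p ≋ []
    ⊖-inverseˡ p = coeffwise λ k →
      trans (coeff-⊕ (⊖ p) p k) (trans (+-congʳ (coeff-⊖ p k)) (-‿inverseˡ _))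

    ·-cong : ∀ {a b p q} → a ≈ b → p ≋ q → a · p ≋ b · q
    ·-cong {a} {b} {p} {q} a≈b e = coeffwise λ k →
      trans (coeff-· a p k) (trans (*-cong a≈b (coeff-≈ e k)) (sym (coeff-· b q k)))

    ·-zeroˡ : ∀ {a} p → a ≈ 0# → a · p ≋ []
    ·-zeroˡ {a} p a≈0 = coeffwise λ k →
      trans (coeff-· a p k) (trans (*-congʳ a≈0) (zeroˡ _))

    ·-distribʳ : ∀ a b p → (a + b) · p ≋ a · p ⊕ b · p
    ·-distribʳ a b p = coeffwise λ k → begin
      coeff ((a + b) · p) k                 ≈⟨ coeff-· (a + b) p k ⟩
      (a + b) * coeff p k                   ≈⟨ distribʳ _ _ _ ⟩
      a * coeff p k + b * coeff p k         ≈⟨ +-cong (coeff-· a p k) (coeff-· b p k) ⟨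
      coeff (a · p) k + coeff (b · p) k     ≈⟨ coeff-⊕ (a · p) (b · p) k ⟨
      coeff (a · p ⊕ b · p) k               ∎

    ·-distribˡ : ∀ a p q → a · (p ⊕ q) ≋ a · p ⊕ a · q
    ·-distribˡ a p q = coeffwise λ k → begin
      coeff (a · (p ⊕ q)) k                 ≈⟨ coeff-· a (p ⊕ q) k ⟩
      a * coeff (p ⊕ q) k                   ≈⟨ *-congˡ (coeff-⊕ p q k) ⟩
      a * (coeff p k + coeff q k)           ≈⟨ distribˡ _ _ _ ⟩
      a * coeff p k + a * coeff q k         ≈⟨ +-cong (coeff-· a p k) (coeff-· a q k) ⟨
      coeff (a · p) k + coeff (a · q) k     ≈⟨ coeff-⊕ (a · p) (a · q) k ⟨
      coeff (a · p ⊕ a · q) k               ∎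

    ·-assoc : ∀ a b p → (a * b) · p ≋ a · (b · p)
    ·-assoc a b p = coeffwise λ k → begin
      coeff ((a * b) · p) k   ≈⟨ coeff-· (a * b) p k ⟩
      a * b * coeff p k       ≈⟨ *-assoc _ _ _ ⟩
      a * (b * coeff p k)     ≈⟨ *-congˡ (coeff-· b p k) ⟨
      a * coeff (b · p) k     ≈⟨ coeff-· a (b · p) k ⟨
      coeff (a · (b · p)) k   ∎

    ·-identity : ∀ p → 1# · p ≋ p
    ·-identity p = coeffwise λ k → trans (coeff-· 1# p k) (*-identityˡ _)

    ·-shift : ∀ a p → a · (0# ∷ p) ≋ 0# ∷ a · p
    ·-shift a p = ∷-cong (zeroʳ a) ≋-refl

    ⊛-congˡ : ∀ p {q q′} → q ≋ q′ → p ⊛ q ≋ p ⊛ q′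
    ⊛-congˡ []      e = ≋-refl
    ⊛-congˡ (a ∷ p) e = ⊕-cong (·-cong refl e) (∷-cong refl (⊛-congˡ p e))

    ⊛-zeroˡ : ∀ p q → p ≋ [] → p ⊛ q ≋ []
    ⊛-zeroˡ []      q e = ≋-refl
    ⊛-zeroˡ (a ∷ p) q e =
      ⊕-cong (·-zeroˡ q (∷≋[]-head e)) (∷≋[] refl (⊛-zeroˡ p q (∷≋[]-tail e)))

    ⊛-congʳ : ∀ p p′ q → p ≋ p′ → p ⊛ q ≋ p′ ⊛ q
    ⊛-congʳ []      p′       q e = ≋-sym (⊛-zeroˡ p′ q (≋-sym e))
    ⊛-congʳ (a ∷ p) []       q e = ⊛-zeroˡ (a ∷ p) q e
    ⊛-congʳ (a ∷ p) (b ∷ p′) q e =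
      ⊕-cong (·-cong (∷-head e) ≋-refl) (∷-cong refl (⊛-congʳ p p′ q (∷-tail e)))

    ⊛-zeroʳ : ∀ p → p ⊛ [] ≋ []
    ⊛-zeroʳ []      = ≋-refl
    ⊛-zeroʳ (a ∷ p) = ∷≋[] refl (⊛-zeroʳ p)

    ⊛-∷ʳ : ∀ p b q → p ⊛ (b ∷ q) ≋ b · p ⊕ (0# ∷ p ⊛ q)
    ⊛-∷ʳ []      b q = ≋-sym 0∷[]
    ⊛-∷ʳ (a ∷ p) b q = ∷-cong (+-congʳ (*-comm a b))
      (≋-trans (⊕-cong ≋-refl (⊛-∷ʳ p b q))
      (≋-trans (≋-sym (⊕-assoc (a · q) (b · p) (0# ∷ p ⊛ q)))
      (≋-trans (⊕-cong (⊕-comm (a · q) (b · p)) ≋-refl)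
               (⊕-assoc (b · p) (a · q) (0# ∷ p ⊛ q)))))

    ⊛-comm : ∀ p q → p ⊛ q ≋ q ⊛ p
    ⊛-comm []      q = ≋-sym (⊛-zeroʳ q)
    ⊛-comm (a ∷ p) q =
      ≋-trans (⊕-cong ≋-refl (∷-cong refl (⊛-comm p q))) (≋-sym (⊛-∷ʳ q a p))

    ⊛-distribʳ : ∀ r p q → (p ⊕ q) ⊛ r ≋ p ⊛ r ⊕ q ⊛ r
    ⊛-distribʳ r []      q       = ≋-refl
    ⊛-distribʳ r (a ∷ p) []      = ≋-sym (⊕-identityʳ _)
    ⊛-distribʳ r (a ∷ p) (b ∷ q) =
      ≋-trans (⊕-cong (·-distribʳ a b r)
                      (∷-cong (sym (+-identityˡ 0#)) (⊛-distribʳ r p q)))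
              (⊕-interchange (a · r) (b · r) (0# ∷ p ⊛ r) (0# ∷ q ⊛ r))

    ·-⊛ : ∀ a p q → (a · p) ⊛ q ≋ a · (p ⊛ q)
    ·-⊛ a []      q = ≋-refl
    ·-⊛ a (b ∷ p) q =
      ≋-trans (⊕-cong (·-assoc a b q)
                      (≋-trans (∷-cong refl (·-⊛ a p q)) (≋-sym (·-shift a (p ⊛ q)))))
              (≋-sym (·-distribˡ a (b · q) (0# ∷ p ⊛ q)))

    shift-⊛ : ∀ {a} p q → a ≈ 0# → (a ∷ p) ⊛ q ≋ 0# ∷ p ⊛ q
    shift-⊛ p q a≈0 = ⊕-cong (·-zeroˡ q a≈0) ≋-refl

    ⊛-shift : ∀ {b} p q → b ≈ 0# → p ⊛ (b ∷ q) ≋ 0# ∷ p ⊛ q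
    ⊛-shift p q b≈0 = ≋-trans (⊛-∷ʳ p _ q) (⊕-cong (·-zeroˡ p b≈0) ≋-refl)

    ⊛-assoc : ∀ p q r → (p ⊛ q) ⊛ r ≋ p ⊛ (q ⊛ r)
    ⊛-assoc []      q r = ≋-refl
    ⊛-assoc (a ∷ p) q r =
      ≋-trans (⊛-distribʳ r (a · q) (0# ∷ p ⊛ q))
              (⊕-cong (·-⊛ a q r)
                      (≋-trans (shift-⊛ (p ⊛ q) r refl) (∷-cong refl (⊛-assoc p q r))))

    ⊛-identityˡ : ∀ p → const 1# ⊛ p ≋ p
    ⊛-identityˡ p = ≋-trans (⊕-cong (·-identity p) 0∷[]) (⊕-identityʳ p)

    -- The constant coefficient of a product is the product of the constant
    -- coefficients; when it vanishes, a factor X cancels.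
    ⊛-integral : ∀ p q → p ⊛ q ≋ [] → p ≋ [] ⊎ q ≋ []
    ⊛-integral []      q       e = inj₁ ≋-refl
    ⊛-integral (a ∷ p) []      e = inj₂ ≋-refl
    ⊛-integral (a ∷ p) (b ∷ q) e =
      [ (λ a≈0 → [ inj₁ ∘ ∷≋[] a≈0 , inj₂ ]′
          (⊛-integral p (b ∷ q)
            (∷≋[]-tail (≋-trans (≋-sym (shift-⊛ p (b ∷ q) a≈0)) e))))
      , (λ b≈0 → [ inj₁ , inj₂ ∘ ∷≋[] b≈0 ]′
          (⊛-integral (a ∷ p) q
            (∷≋[]-tail (≋-trans (≋-sym (⊛-shift (a ∷ p) q b≈0)) e))))
      ]′ (integral a b (trans (sym (+-identityʳ _)) (∷≋[]-head e)))

    _≋0? : ∀ p → Dec (p ≋ [])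
    [] ≋0? = yes ≋-refl
    (a ∷ p) ≋0? with a ≟0 | p ≋0?
    ... | yes a≈0 | yes p≋0 = yes (∷≋[] a≈0 p≋0)
    ... | no  a≉0 | _       = no (a≉0 ∘ ∷≋[]-head)
    ... | yes _   | no p≋̸0  = no (p≋̸0 ∘ ∷≋[]-tail)

  polynomialRing : CommutativeRing 0ℓ 0ℓ
  polynomialRing = record
    { Carrier = Poly
    ; _≈_ = _≋_
    ; _+_ = _⊕_
    ; _*_ = _⊛_
    ; -_  = ⊖_
    ; 0#  = []
    ; 1#  = const 1#
    ; isCommutativeRing = record
      { isRing = record
        { +-isAbelianGroup = record
          { isGroup = record
            { isMonoid = record
              { isSemigroup = record
                { isMagma = record
                  { isEquivalence = record
                    { refl = ≋-refl ; sym = ≋-sym ; trans = ≋-trans }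
                  ; ∙-cong = ⊕-cong
                  }
                ; assoc = ⊕-assoc
                }
              ; identity = (λ _ → ≋-refl) , ⊕-identityʳ
              }
            ; inverse = ⊖-inverseˡ , λ p → ≋-trans (⊕-comm p (⊖ p)) (⊖-inverseˡ p)
            ; ⁻¹-cong = ⊖-cong
            }
          ; comm = ⊕-comm
          }
        ; *-cong = λ {p} {p′} {q} {q′} e f →
            ≋-trans (⊛-congʳ p p′ q e) (⊛-congˡ p′ f)
        ; *-assoc = ⊛-assoc
        ; *-identity = ⊛-identityˡ , λ p → ≋-trans (⊛-comm p (const 1#)) (⊛-identityˡ p)
        ; distrib = (λ p q r → ≋-trans (⊛-comm p (q ⊕ r))
                        (≋-trans (⊛-distribʳ p q r) (⊕-cong (⊛-comm q p) (⊛-comm r p))))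
                  , ⊛-distribʳ
        }
      ; *-comm = ⊛-comm
      }
    }

  polynomialDomain : IntegralDomain
  polynomialDomain = record
    { commutativeRing = polynomialRing
    ; 1≉0             = λ e → 1≉0 (∷≋[]-head e)
    ; integral        = ⊛-integral
    ; _≟0             = _≋0?
    }

module FractionIdentities (R : CommutativeRing 0ℓ 0ℓ) where
  open CommutativeRing R
  open SemiringSolver commutativeSemiring using (solve; _:=_; _:+_; _:*_)

  swap₃ : ∀ x y z → x * y * z ≈ x * z * y
  swap₃ = solve 3
    (λ x y z → x :* y :* z := x :* z :* y)
    refl

  expand₁ : ∀ a b c d b′ d′ →
    (a * d + c * b) * (b′ * d′) ≈ a * b′ * (d * d′) + c * d′ * (b * b′)
  expand₁ = solve 6
    (λ a b c d b′ d′ → (a :* d :+ c :* b) :* (b′ :* d′) := a :* b′ :* (d :* d′) :+ c :* d′ :* (b :* b′))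
    refl

  expand₂ : ∀ a b c d b′ d′ →
    a * b′ * (d′ * d) + c * d′ * (b′ * b) ≈ (a * d + c * b) * (b′ * d′)
  expand₂ = solve 6
    (λ a b c d b′ d′ → a :* b′ :* (d′ :* d) :+ c :* d′ :* (b′ :* b) := (a :* d :+ c :* b) :* (b′ :* d′))
    refl

  interchange : ∀ a b c d → a * b * (c * d) ≈ a * c * (b * d)
  interchange = solve 4
    (λ a b c d → a :* b :* (c :* d) := a :* c :* (b :* d))
    refl

  +ᶠ-assoc′ : ∀ a b c d k l →
    ((a * d + c * b) * l + k * (b * d)) * (b * (d * l))
    ≈ (a * (d * l) + (c * l + k * d) * b) * (b * d * l)
  +ᶠ-assoc′ = solve 6
    (λ a b c d k l → ((a :* d :+ c :* b) :* l :+ k :* (b :* d)) :* (b :* (d :* l)) := (a :* (d :* l) :+ (c :* l :+ k :* d) :* b) :* (b :* d :* l))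
    refl

  +ᶠ-comm′ : ∀ a b c d → (a * d + c * b) * (d * b) ≈ (c * b + a * d) * (b * d)
  +ᶠ-comm′ = solve 4
    (λ a b c d → (a :* d :+ c :* b) :* (d :* b) := (c :* b :+ a :* d) :* (b :* d))
    refl

  *ᶠ-assoc′ : ∀ a b c d k l →
    a * c * k * (b * (d * l)) ≈ a * (c * k) * (b * d * l)
  *ᶠ-assoc′ = solve 6
    (λ a b c d k l → a :* c :* k :* (b :* (d :* l)) := a :* (c :* k) :* (b :* d :* l))
    refl

  *ᶠ-comm′ : ∀ a b c d → a * c * (d * b) ≈ c * a * (b * d)
  *ᶠ-comm′ = solve 4
    (λ a b c d → a :* c :* (d :* b) := c :* a :* (b :* d))
    refl

  distribˡ′ : ∀ a b c d k l →
    a * (c * l + k * d) * (b * d * (b * l))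
    ≈ (a * c * (b * l) + a * k * (b * d)) * (b * (d * l))
  distribˡ′ = solve 6
    (λ a b c d k l → a :* (c :* l :+ k :* d) :* (b :* d :* (b :* l)) := (a :* c :* (b :* l) :+ a :* k :* (b :* d)) :* (b :* (d :* l)))
    refl

module FractionField (D : IntegralDomain) where
  open IntegralDomain D hiding (zero)
  open FractionIdentities commutativeRing
  open RingProperties ring using (-‿distribˡ-*; x∙y⁻¹≈ε⇒x≈y; [y-z]x≈yx-zx)
  open SetoidReasoning setoid

  record Fraction : Set where
    constructor _/_[_]
    field
      num   : Carrier
      den   : Carrier
      den≉0 : ¬ (den ≈ 0#)
  open Fraction

  infix  4 _≃_
  infixl 6 _+ᶠ_
  infixl 7 _*ᶠ_

  record _≃_ (f g : Fraction) : Set where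
    constructor cross
    field cross-≈ : num f * den g ≈ num g * den f
  open _≃_

  private
    *-≉0 : ∀ {a b} → ¬ (a ≈ 0#) → ¬ (b ≈ 0#) → ¬ (a * b ≈ 0#)
    *-≉0 a≉0 b≉0 ab≈0 = [ a≉0 , b≉0 ]′ (integral _ _ ab≈0)

  _+ᶠ_ : Fraction → Fraction → Fraction
  (a / b [ b≉0 ]) +ᶠ (c / d [ d≉0 ]) = (a * d + c * b) / b * d [ *-≉0 b≉0 d≉0 ]

  _*ᶠ_ : Fraction → Fraction → Fraction
  (a / b [ b≉0 ]) *ᶠ (c / d [ d≉0 ]) = (a * c) / b * d [ *-≉0 b≉0 d≉0 ]

  -ᶠ_ : Fraction → Fraction
  -ᶠ (a / b [ b≉0 ]) = (- a) / b [ b≉0 ]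

  embed : Carrier → Fraction
  embed a = a / 1# [ 1≉0 ]

  -- Total inverse, with the convention 0⁻¹ = 0.
  infix 8 _⁻¹
  _⁻¹ : Fraction → Fraction
  (a / b [ _ ]) ⁻¹ with a ≟0
  ... | yes _   = embed 0#
  ... | no  a≉0 = b / a [ a≉0 ]

  private
    cancel : ∀ {x y} c → ¬ (c ≈ 0#) → x * c ≈ y * c → x ≈ y
    cancel {x} {y} c c≉0 e =
      [ x∙y⁻¹≈ε⇒x≈y x y , (λ c≈0 → contradiction c≈0 c≉0) ]′
        (integral (x - y) c (begin
          (x - y) * c       ≈⟨ [y-z]x≈yx-zx c x y ⟩
          x * c - y * c     ≈⟨ +-congʳ e ⟩
          y * c - y * c     ≈⟨ -‿inverseʳ _ ⟩
          0#                ∎))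

    ≃-refl : ∀ {f} → f ≃ f
    ≃-refl = cross refl

    ≃-sym : ∀ {f g} → f ≃ g → g ≃ f
    ≃-sym e = cross (sym (cross-≈ e))

    ≃-trans : ∀ {f g h} → f ≃ g → g ≃ h → f ≃ h
    ≃-trans {a / b [ _ ]} {c / d [ d≉0 ]} {k / l [ _ ]} (cross ad≈cb) (cross cl≈kd) =
      cross (cancel d d≉0 (begin
        a * l * d ≈⟨ swap₃ a l d ⟩
        a * d * l ≈⟨ *-congʳ ad≈cb ⟩
        c * b * l ≈⟨ swap₃ c b l ⟩
        c * l * b ≈⟨ *-congʳ cl≈kd ⟩
        k * d * b ≈⟨ swap₃ k d b ⟩
        k * b * d ∎))

    +ᶠ-cong : ∀ {f f′ g g′} → f ≃ f′ → g ≃ g′ → f +ᶠ g ≃ f′ +ᶠ g′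
    +ᶠ-cong {a / b [ _ ]} {a′ / b′ [ _ ]} {c / d [ _ ]} {c′ / d′ [ _ ]} (cross e) (cross f) =
      cross (begin
        (a * d + c * b) * (b′ * d′)             ≈⟨ expand₁ a b c d b′ d′ ⟩
        a * b′ * (d * d′) + c * d′ * (b * b′)   ≈⟨ +-cong (*-congʳ e) (*-congʳ f) ⟩
        a′ * b * (d * d′) + c′ * d * (b * b′)   ≈⟨ expand₂ a′ b′ c′ d′ b d ⟩
        (a′ * d′ + c′ * b′) * (b * d)           ∎)

    *ᶠ-cong : ∀ {f f′ g g′} → f ≃ f′ → g ≃ g′ → f *ᶠ g ≃ f′ *ᶠ g′
    *ᶠ-cong {a / b [ _ ]} {a′ / b′ [ _ ]} {c / d [ _ ]} {c′ / d′ [ _ ]} (cross e) (cross f) =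
      cross (begin
        a * c * (b′ * d′)    ≈⟨ interchange a c b′ d′ ⟩
        a * b′ * (c * d′)    ≈⟨ *-cong e f ⟩
        a′ * b * (c′ * d)    ≈⟨ interchange a′ b c′ d ⟩
        a′ * c′ * (b * d)    ∎)

    -ᶠ-cong : ∀ {f g} → f ≃ g → -ᶠ f ≃ -ᶠ g
    -ᶠ-cong {a / b [ _ ]} {c / d [ _ ]} (cross e) = cross (begin
      - a * d     ≈⟨ -‿distribˡ-* a d ⟨
      - (a * d)   ≈⟨ -‿cong e ⟩
      - (c * b)   ≈⟨ -‿distribˡ-* c b ⟩
      - c * b     ∎)

    +ᶠ-assoc : ∀ f g h → (f +ᶠ g) +ᶠ h ≃ f +ᶠ (g +ᶠ h)
    +ᶠ-assoc (a / b [ _ ]) (c / d [ _ ]) (k / l [ _ ]) = cross (+ᶠ-assoc′ a b c d k l)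

    +ᶠ-comm : ∀ f g → f +ᶠ g ≃ g +ᶠ f
    +ᶠ-comm (a / b [ _ ]) (c / d [ _ ]) = cross (+ᶠ-comm′ a b c d)

    +ᶠ-identityˡ : ∀ f → embed 0# +ᶠ f ≃ f
    +ᶠ-identityˡ (a / b [ _ ]) = cross (begin
      (0# * b + a * 1#) * b   ≈⟨ *-congʳ (+-cong (zeroˡ b) (*-identityʳ a)) ⟩
      (0# + a) * b            ≈⟨ *-congʳ (+-identityˡ a) ⟩
      a * b                   ≈⟨ *-congˡ (*-identityˡ b) ⟨
      a * (1# * b)            ∎)

    -ᶠ-inverseˡ : ∀ f → -ᶠ f +ᶠ f ≃ embed 0#
    -ᶠ-inverseˡ (a / b [ _ ]) = cross (begin
      (- a * b + a * b) * 1#   ≈⟨ *-identityʳ _ ⟩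
      - a * b + a * b          ≈⟨ distribʳ b (- a) a ⟨
      (- a + a) * b            ≈⟨ *-congʳ (-‿inverseˡ a) ⟩
      0# * b                   ≈⟨ zeroˡ b ⟩
      0#                       ≈⟨ zeroˡ (b * b) ⟨
      0# * (b * b)             ∎)

    *ᶠ-assoc : ∀ f g h → (f *ᶠ g) *ᶠ h ≃ f *ᶠ (g *ᶠ h)
    *ᶠ-assoc (a / b [ _ ]) (c / d [ _ ]) (k / l [ _ ]) = cross (*ᶠ-assoc′ a b c d k l)

    *ᶠ-comm : ∀ f g → f *ᶠ g ≃ g *ᶠ f
    *ᶠ-comm (a / b [ _ ]) (c / d [ _ ]) = cross (*ᶠ-comm′ a b c d)

    *ᶠ-identityˡ : ∀ f → embed 1# *ᶠ f ≃ f
    *ᶠ-identityˡ (a / b [ _ ]) = cross (begin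
      1# * a * b     ≈⟨ *-congʳ (*-identityˡ a) ⟩
      a * b          ≈⟨ *-congˡ (*-identityˡ b) ⟨
      a * (1# * b)   ∎)

    *ᶠ-distribˡ : ∀ f g h → f *ᶠ (g +ᶠ h) ≃ f *ᶠ g +ᶠ f *ᶠ h
    *ᶠ-distribˡ (a / b [ _ ]) (c / d [ _ ]) (k / l [ _ ]) = cross (distribˡ′ a b c d k l)

    *ᶠ-distribʳ : ∀ f g h → (g +ᶠ h) *ᶠ f ≃ g *ᶠ f +ᶠ h *ᶠ f
    *ᶠ-distribʳ f g h = ≃-trans (*ᶠ-comm (g +ᶠ h) f)
      (≃-trans (*ᶠ-distribˡ f g h) (+ᶠ-cong (*ᶠ-comm f g) (*ᶠ-comm f h)))

  fractionRing : CommutativeRing 0ℓ 0ℓ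
  fractionRing = record
    { Carrier = Fraction
    ; _≈_ = _≃_
    ; _+_ = _+ᶠ_
    ; _*_ = _*ᶠ_
    ; -_  = -ᶠ_
    ; 0#  = embed 0#
    ; 1#  = embed 1#
    ; isCommutativeRing = record
      { isRing = record
        { +-isAbelianGroup = record
          { isGroup = record
            { isMonoid = record
              { isSemigroup = record
                { isMagma = record
                  { isEquivalence = record
                    { refl = ≃-refl ; sym = ≃-sym ; trans = ≃-trans }
                  ; ∙-cong = +ᶠ-cong
                  }
                ; assoc = +ᶠ-assoc
                }
              ; identity = +ᶠ-identityˡ
                         , λ f → ≃-trans (+ᶠ-comm f (embed 0#)) (+ᶠ-identityˡ f)
              }
            ; inverse = -ᶠ-inverseˡ , λ f → ≃-trans (+ᶠ-comm f (-ᶠ f)) (-ᶠ-inverseˡ f)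
            ; ⁻¹-cong = -ᶠ-cong
            }
          ; comm = +ᶠ-comm
          }
        ; *-cong = *ᶠ-cong
        ; *-assoc = *ᶠ-assoc
        ; *-identity = *ᶠ-identityˡ
                     , λ f → ≃-trans (*ᶠ-comm f (embed 1#)) (*ᶠ-identityˡ f)
        ; distrib = *ᶠ-distribˡ , *ᶠ-distribʳ
        }
      ; *-comm = *ᶠ-comm
      }
    }

  ⁻¹-inverseʳ : ∀ f → ¬ (f ≃ embed 0#) → f *ᶠ f ⁻¹ ≃ embed 1#
  ⁻¹-inverseʳ (a / b [ _ ]) f≉0 with a ≟0
  ... | yes a≈0 = contradiction (cross (begin
          a * 1#   ≈⟨ *-congʳ a≈0 ⟩
          0# * 1#  ≈⟨ zeroˡ 1# ⟩
          0#       ≈⟨ zeroˡ b ⟨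
          0# * b   ∎)) f≉0
  ... | no  _   = cross (begin
          a * b * 1#    ≈⟨ *-identityʳ _ ⟩
          a * b         ≈⟨ *-comm a b ⟩
          b * a         ≈⟨ *-identityˡ _ ⟨
          1# * (b * a)  ∎)

ℚ-domain : IntegralDomain
ℚ-domain = record
  { commutativeRing = ℚ.+-*-commutativeRing
  ; 1≉0             = ℚ.1≢0
  ; integral        = integral
  ; _≟0             = ℚ._≟ 0ℚ
  }
  where
  integral : ∀ x y → x ℚ.* y ≡ 0ℚ → x ≡ 0ℚ ⊎ y ≡ 0ℚ
  integral x y xy≡0 with x ℚ.≟ 0ℚ
  ... | yes x≡0 = inj₁ x≡0
  ... | no  x≢0 = inj₂ (begin
    y                       ≡⟨ ℚ.*-identityˡ y ⟨
    1ℚ ℚ.* y                ≡⟨ ≡.cong (ℚ._* y) (ℚ.*-inverseˡ x) ⟨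
    ℚ.1/ x ℚ.* x ℚ.* y      ≡⟨ ℚ.*-assoc (ℚ.1/ x) x y ⟩
    ℚ.1/ x ℚ.* (x ℚ.* y)    ≡⟨ ≡.cong (ℚ.1/ x ℚ.*_) xy≡0 ⟩
    ℚ.1/ x ℚ.* 0ℚ           ≡⟨ ℚ.*-zeroʳ (ℚ.1/ x) ⟩
    0ℚ                      ∎)
    where
    open ≡.≡-Reasoning
    instance
      x-nonZero : ℚ.NonZero x
      x-nonZero = ℚ.≢-nonZero x≢0

-- ℚ[x₁,…,xₙ], built by adjoining one indeterminate at a time.
ℚ[x] : ℕ → IntegralDomain
ℚ[x] zero    = ℚ-domain
ℚ[x] (suc n) = Polynomial.polynomialDomain (ℚ[x] n)

indeterminate : ∀ {n} → Fin n → IntegralDomain.Carrier (ℚ[x] n)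
indeterminate {suc n} zero    = Polynomial.X (ℚ[x] n)
indeterminate {suc n} (suc i) = Polynomial.const (ℚ[x] n) (indeterminate i)

ℚ⟨x⟩ : ℕ → CommutativeRing 0ℓ 0ℓ
ℚ⟨x⟩ n = FractionField.fractionRing (ℚ[x] n)

module _ {n : ℕ} where
  open CommutativeRing (ℚ⟨x⟩ n) using (Carrier; _+_; _*_; _-_; 0#; 1#)
  open FractionField (ℚ[x] n) using (embed; _⁻¹)

  x[_] : Fin n → Carrier
  x[ i ] = embed (indeterminate i)

  -- The product of the differences of consecutive indeterminates along
  -- i ∷ w, followed by the difference of the last one and x[ first ].
  differences : Fin n → Fin n → List (Fin n) → Carrier
  differences first i []      = x[ i ] - x[ first ]
  differences first i (j ∷ w) = (x[ i ] - x[ j ]) * differences first j w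

  -- For n = 1 the denominator vanishes, and the value is 0 by the convention
  -- on inverses.
  Ψ-order : List (Fin n) → Carrier
  Ψ-order []      = 1#
  Ψ-order (i ∷ w) = differences i i w ⁻¹

  Ψ-tor : {Q : Quiver n} → ℒ-tor Q → Carrier
  Ψ-tor ℒ = foldr (λ w f → Ψ-order w + f) 0# (representatives ℒ)

{-# OPTIONS --safe #-}

-- Whether [w] is a toric total extension of [Q] depends only on the
-- orientation that w induces on G, so rotate every extension to start with a
-- vertex v such that the remaining vertices split into two nonempty sides
-- without edges between them (the cut vertex, or any third vertex when G is
-- disconnected). Re-shuffling the two sides of v u does not change the induced
-- orientation, hence the extensions fall into complete shuffle classes. With
--   C(p; u; q) = 1 / ((x_p - x_{u_1}) (x_{u_1} - x_{u_2}) ⋯ (x_{u_m} - x_q)),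
-- the sum of C(p; u; q) over all shuffles u of a and b is
--   (x_p - x_q) C(p; a; q) C(p; b; q),
-- which vanishes at p = q = v.

module Submission where

open import Level using (0ℓ)
open import Algebra.Bundles using (CommutativeRing)
import Algebra.Properties.Ring as RingProperties
import Algebra.Solver.Ring.NaturalCoefficients.Default as SemiringSolver
open import Data.Fin.Base using (Fin; zero; suc)
import Data.Fin.Properties as Fin
open import Data.Integer.Base as ℤ using (ℤ; -[1+_])
import Data.Integer.Properties as ℤ
open import Data.List.Base using (List; []; _∷_; _++_; _∷ʳ_; map; foldr; filter; length; allFin)
open import Data.List.Membership.Propositional using (_∈_; _∉_)
open import Data.List.Membership.Propositional.Properties
  using (∈-map⁻; ∈-map⁺; ∈-++⁻; ∈-++⁺ˡ; ∈-++⁺ʳ; ∈-filter⁺; ∈-filter⁻; ∈-allFin; ∈-∃++; ∈-insert)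
open import Data.List.Membership.Propositional.Properties.WithK using (unique∧set⇒bag)
import Data.List.Properties as List
open import Data.List.Relation.Binary.BagAndSetEquality using (∼bag⇒↭)
open import Data.List.Relation.Binary.Permutation.Propositional as ↭
  using (_↭_; prep; swap; ↭-refl; ↭-sym; ↭-trans; ↭-reflexive; ↭⇒↭ₛ)
import Data.List.Relation.Binary.Permutation.Propositional.Properties as ↭
import Data.List.Relation.Binary.Permutation.Setoid.Properties as ↭ₛ
open import Data.List.Relation.Binary.Pointwise.Base using (Pointwise; []; _∷_)
open import Data.List.Relation.Unary.All as All using (All; []; _∷_)
import Data.List.Relation.Unary.All.Properties as All
open import Data.List.Relation.Unary.AllPairs using (AllPairs; []; _∷_)
open import Data.List.Relation.Unary.Any as Any using (Any; here; there)
open import Data.List.Relation.Unary.Linked as Linked using (Linked)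
open import Data.List.Relation.Unary.Linked.Properties using (Linked⇒AllPairs; AllPairs⇒Linked)
open import Data.List.Relation.Unary.Unique.Propositional using (Unique)
open import Data.List.Relation.Unary.Unique.Propositional.Properties
  using (map⁺; ++⁺; filter⁺; allFin⁺; Unique[x∷xs]⇒x∉xs)
open import Data.Nat.Base as ℕ using (ℕ; zero; suc; _≤_; _<_; z≤n; s≤s; z<s; s<s; s<s⁻¹)
open import Data.Nat.Induction using (<-wellFounded)
import Data.Nat.Properties as ℕ
open import Data.Product.Base as Product using (∃; ∃₂; _×_; _,_; proj₁; proj₂)
open import Data.Product.Properties using (≡-dec; ,-injectiveˡ; ,-injectiveʳ)
open import Data.Rational.Base as ℚ using (ℚ; 0ℚ; 1ℚ)
import Data.Rational.Properties as ℚ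
import Data.Rational.Unnormalised.Base as ℚᵘ
import Data.Rational.Unnormalised.Properties as ℚᵘ
open import Data.Sum.Base as Sum using (_⊎_; inj₁; inj₂)
open import Function.Base using (_∘_)
open import Function.Bundles using (_⇔_; mk⇔; Equivalence)
import Function.Properties.Equivalence as ⇔
open import Induction.WellFounded using (Acc; acc)
open import Relation.Binary.Construct.Closure.ReflexiveTransitive as Star using (Star; ε; _◅_; _◅◅_)
open import Relation.Binary.Construct.Closure.Transitive using (TransClosure; [_]; _∷_)
open import Relation.Binary.Core using (Rel)
open import Relation.Binary.Definitions
  using (DecidableEquality; Symmetric; Transitive; tri<; tri≈; tri>)
open import Relation.Binary.PropositionalEquality as ≡ using (_≡_; _≢_)
import Relation.Binary.Reasoning.Setoid as SetoidReasoning
open import Relation.Nullary using (¬_; yes; no; contradiction; ¬?)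
open import Relation.Nullary.Decidable using (_×-dec_; _⊎-dec_)
open import Relation.Unary using (Pred; Decidable; U)
open import Relation.Unary.Properties using (∁?)
open import Defs

open Equivalence using (to; from)

-- Shuffles

module _ {A : Set} where

  shuffles : List A → List A → List (List A)
  shuffles []       ys       = ys ∷ []
  shuffles (x ∷ xs) []       = (x ∷ xs) ∷ []
  shuffles (x ∷ xs) (y ∷ ys) =
    map (x ∷_) (shuffles xs (y ∷ ys)) ++ map (y ∷_) (shuffles (x ∷ xs) ys)

  shuffles-[]ʳ : ∀ xs → shuffles xs [] ≡ xs ∷ []
  shuffles-[]ʳ []       = ≡.refl
  shuffles-[]ʳ (_ ∷ _) = ≡.refl

  module _ {P : Pred A 0ℓ} (P? : Decidable P) where

    -- Together with `filter-shuffle`, this makes `shuffles xs ys` the fibre over `(xs , ys)` of the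
    -- map sending a list to its two filters, when `P` holds throughout `xs` and fails throughout
    -- `ys`.
    ∈-shuffles-filter : ∀ us → us ∈ shuffles (filter P? us) (filter (∁? P?) us)
    ∈-shuffles-filter [] = here ≡.refl
    ∈-shuffles-filter (u ∷ us) with P? u | ∈-shuffles-filter us
    ... | yes _ | ∈s with filter (∁? P?) us
    ...   | y ∷ ys = ∈-++⁺ˡ (∈-map⁺ (u ∷_) ∈s)
    ...   | [] rewrite shuffles-[]ʳ (filter P? us) with ∈s
    ...     | here eq = here (≡.cong (u ∷_) eq)
    ∈-shuffles-filter (u ∷ us) | no _ | ∈s with filter P? us
    ...   | x ∷ xs = ∈-++⁺ʳ _ (∈-map⁺ (u ∷_) ∈s)
    ...   | [] with ∈s
    ...     | here eq = here (≡.cong (u ∷_) eq)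

    filter-all-accept : ∀ {xs} → All P xs →
      filter P? xs ≡ xs × filter (∁? P?) xs ≡ []
    filter-all-accept [] = ≡.refl , ≡.refl
    filter-all-accept {x ∷ _} (p ∷ ps) with P? x | filter-all-accept ps
    ... | yes _ | e , f = ≡.cong (x ∷_) e , f
    ... | no ¬p | _     = contradiction p ¬p

    filter-all-reject : ∀ {xs} → All (¬_ ∘ P) xs →
      filter P? xs ≡ [] × filter (∁? P?) xs ≡ xs
    filter-all-reject [] = ≡.refl , ≡.refl
    filter-all-reject {x ∷ _} (p ∷ ps) with P? x | filter-all-reject ps
    ... | yes p′ | _     = contradiction p′ p
    ... | no _   | e , f = e , ≡.cong (x ∷_) f

    filter-shuffle : ∀ {xs ys us} → All P xs → All (¬_ ∘ P) ys → us ∈ shuffles xs ys →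
      filter P? us ≡ xs × filter (∁? P?) us ≡ ys
    filter-shuffle []           nys          (here ≡.refl) = filter-all-reject nys
    filter-shuffle pxs@(_ ∷ _)  []           (here ≡.refl) = filter-all-accept pxs
    filter-shuffle {x ∷ xs} {y ∷ ys} (p ∷ pxs) (q ∷ nys) us∈
      with ∈-++⁻ (map (x ∷_) (shuffles xs (y ∷ ys))) us∈
    ... | inj₁ us∈ˡ with _ , vs∈ , ≡.refl ← ∈-map⁻ _ us∈ˡ
                    with P? x | filter-shuffle pxs (q ∷ nys) vs∈
    ...   | yes _ | e , f = ≡.cong (x ∷_) e , f
    ...   | no ¬p | _     = contradiction p ¬p
    filter-shuffle {x ∷ xs} {y ∷ ys} (p ∷ pxs) (q ∷ nys) us∈
        | inj₂ us∈ʳ with _ , vs∈ , ≡.refl ← ∈-map⁻ _ us∈ʳ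
                    with P? y | filter-shuffle (p ∷ pxs) nys vs∈
    ...   | yes q′ | _     = contradiction q′ q
    ...   | no _   | e , f = e , ≡.cong (y ∷_) f

    -- A shuffle starting with the head of `xs` differs from one starting with the head of `ys`,
    -- because `P` holds at the first head and fails at the second.
    shuffles-unique : ∀ {xs ys} → All P xs → All (¬_ ∘ P) ys → Unique (shuffles xs ys)
    shuffles-unique []        _         = [] ∷ []
    shuffles-unique (_ ∷ _)   []        = [] ∷ []
    shuffles-unique (p ∷ pxs) (q ∷ nys) =
      ++⁺ (map⁺ List.∷-injectiveʳ (shuffles-unique pxs (q ∷ nys)))
          (map⁺ List.∷-injectiveʳ (shuffles-unique (p ∷ pxs) nys))
          heads-differ
      where
      heads-differ : ∀ {us} → us ∈ map _ _ × us ∈ map _ _ → _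
      heads-differ (us∈ˡ , us∈ʳ) with _ , _ , ≡.refl ← ∈-map⁻ _ us∈ˡ
                             with _ , _ , e ← ∈-map⁻ _ us∈ʳ =
        q (≡.subst P (List.∷-injectiveˡ e) p)

-- Sums of products of inverse differences

module Sums (R : CommutativeRing 0ℓ 0ℓ) where
  open CommutativeRing R
  open SemiringSolver commutativeSemiring using (solve; _:=_; _:+_; _:*_)
  open SetoidReasoning setoid

  module _ {A : Set} (f : A → Carrier) where

    sum : List A → Carrier
    sum = foldr (λ x s → f x + s) 0#

    sum-↭ : ∀ {xs ys} → xs ↭ ys → sum xs ≈ sum ys
    sum-↭ ↭.refl          = refl
    sum-↭ (prep _ p)      = +-congˡ (sum-↭ p)
    sum-↭ (swap x y p)    = trans (+-congˡ (+-congˡ (sum-↭ p)))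
                              (solve 3 (λ a b c → a :+ (b :+ c) := b :+ (a :+ c)) refl _ _ _)
    sum-↭ (↭.trans p q)   = trans (sum-↭ p) (sum-↭ q)

    sum-++ : ∀ xs ys → sum (xs ++ ys) ≈ sum xs + sum ys
    sum-++ []       ys = sym (+-identityˡ _)
    sum-++ (x ∷ xs) ys = trans (+-congˡ (sum-++ xs ys)) (sym (+-assoc _ _ _))

    sum-filter : ∀ {P : Pred A 0ℓ} (P? : Decidable P) xs →
      sum xs ≈ sum (filter P? xs) + sum (filter (∁? P?) xs)
    sum-filter P? []       = sym (+-identityˡ _)
    sum-filter P? (x ∷ xs) with P? x
    ... | yes _ = trans (+-congˡ (sum-filter P? xs)) (sym (+-assoc _ _ _))
    ... | no  _ = trans (+-congˡ (sum-filter P? xs))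
                    (solve 3 (λ a b c → a :+ (b :+ c) := b :+ (a :+ c)) refl _ _ _)

    module _ {K : Set} (_≟ᴷ_ : DecidableEquality K) (key : A → K) (fibre : A → List A) where

      IsFibre : A → Set
      IsFibre x = Unique (fibre x) × (∀ {y} → y ∈ fibre x ⇔ key y ≡ key x)

      -- Peel off the fibre of the first element. Closure under `key` and uniqueness make the
      -- elements sharing its key a permutation of that fibre, whose sum is zero; the remaining list
      -- is shorter and inherits the hypotheses.
      sum-fibres : ∀ {xs} → (∀ {x} → x ∈ xs → IsFibre x × sum (fibre x) ≈ 0#) →
        Unique xs → (∀ {x y} → x ∈ xs → key y ≡ key x → y ∈ xs) →
        sum xs ≈ 0#
      sum-fibres = go _ (<-wellFounded _)
        where
        go : ∀ xs → Acc _<_ (length xs) → (∀ {x} → x ∈ xs → IsFibre x × sum (fibre x) ≈ 0#) →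
          Unique xs → (∀ {x y} → x ∈ xs → key y ≡ key x → y ∈ xs) →
          sum xs ≈ 0#
        go []       _         _   _ _      = refl
        go (x ∷ xs) (acc rec) fib u closed = begin
          sum (x ∷ xs)                           ≈⟨ sum-filter same? (x ∷ xs) ⟩
          sum (filter same? (x ∷ xs)) + sum rest ≈⟨ +-cong (sum-↭ filter↭fibre) rest≈0 ⟩
          sum (fibre x) + 0#                     ≈⟨ +-identityʳ _ ⟩
          sum (fibre x)                          ≈⟨ proj₂ (fib (here ≡.refl)) ⟩
          0#                                     ∎
          where
          same? = λ y → key y ≟ᴷ key x
          rest  = filter (∁? same?) (x ∷ xs)
          filter↭fibre : filter same? (x ∷ xs) ↭ fibre x
          filter↭fibre = let uniq , ∈fibre = proj₁ (fib (here ≡.refl)) in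
            ∼bag⇒↭ (unique∧set⇒bag (filter⁺ same? u) uniq
              (mk⇔ (λ y∈ → from ∈fibre (proj₂ (∈-filter⁻ same? {xs = x ∷ xs} y∈)))
                   (λ y∈ → ∈-filter⁺ same? (closed (here ≡.refl) (to ∈fibre y∈)) (to ∈fibre y∈))))
          ∈-rest : ∀ {y} → y ∈ rest → y ∈ x ∷ xs × key y ≢ key x
          ∈-rest = ∈-filter⁻ (∁? same?) {xs = x ∷ xs}
          rest≈0 : sum rest ≈ 0#
          rest≈0 = go rest
            (rec (List.filter-notAll (∁? same?) (x ∷ xs) (here (λ k → k ≡.refl))))
            (fib ∘ proj₁ ∘ ∈-rest) (filter⁺ (∁? same?) u)
            (λ y∈ e → let y∈′ , y≁x = ∈-rest y∈ in
              ∈-filter⁺ (∁? same?) (closed y∈′ e) (y≁x ∘ ≡.trans (≡.sym e)))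

  sum-map : ∀ {A B : Set} (f : B → Carrier) (g : A → B) xs → sum f (map g xs) ≡ sum (f ∘ g) xs
  sum-map f g []       = ≡.refl
  sum-map f g (x ∷ xs) = ≡.cong (f (g x) +_) (sum-map f g xs)

  sum-*ˡ : ∀ {A : Set} (f : A → Carrier) c xs → sum (λ x → c * f x) xs ≈ c * sum f xs
  sum-*ˡ f c []       = sym (zeroʳ c)
  sum-*ˡ f c (x ∷ xs) = trans (+-congˡ (sum-*ˡ f c xs)) (sym (distribˡ _ _ _))

  -- Partial fractions and the shuffle identity

  module CyclicProducts {I : Set} (x : I → Carrier) (inv : I → I → Carrier)
    (x-inverse : ∀ {i j} → i ≢ j → (x i - x j) * inv i j ≈ 1#) where

    -- The product `C(p; is; q)`, with free ends so that removing the first letter leaves another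
    -- chain. A factor `inv i i` has no specified value.
    chain : I → List I → I → Carrier
    chain p []       q = inv p q
    chain p (i ∷ is) q = inv p i * chain i is q

    telescope : ∀ i j k → (x i - x j) + (x j - x k) ≈ x i - x k
    telescope i j k = begin
      (x i - x j) + (x j - x k)       ≈⟨ solve 4 (λ a b c d → (a :+ b) :+ (c :+ d) := (a :+ d) :+ (b :+ c))
                                                refl (x i) (- x j) (x j) (- x k) ⟩
      (x i - x k) + (- x j + x j)     ≈⟨ +-congˡ (-‿inverseˡ (x j)) ⟩
      (x i - x k) + 0#                ≈⟨ +-identityʳ _ ⟩
      x i - x k                       ∎

    inv-antisym : ∀ {i j} → i ≢ j → inv i j + inv j i ≈ 0#
    inv-antisym {i} {j} i≢j = begin
      X + Y                     ≈⟨ +-cong (*-identityʳ X) (*-identityʳ Y) ⟨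
      X * 1# + Y * 1#           ≈⟨ +-cong (*-congˡ (x-inverse (i≢j ∘ ≡.sym)))
                                          (*-congˡ (x-inverse i≢j)) ⟨
      X * (d′ * Y) + Y * (d * X)
        ≈⟨ solve 4 (λ d d′ X Y → X :* (d′ :* Y) :+ Y :* (d :* X) := X :* Y :* (d :+ d′))
             refl d d′ X Y ⟩
      X * Y * (d + d′)          ≈⟨ *-congˡ (trans (telescope i j i) (-‿inverseʳ (x i))) ⟩
      X * Y * 0#                ≈⟨ zeroʳ _ ⟩
      0#                        ∎
      where
      X = inv i j ; Y = inv j i ; d = x i - x j ; d′ = x j - x i

    -- A partial fraction identity. In the local notation, factoring out `A * M * (B * N)` leaves
    -- `(e + d) * (d + f) * X + e * f * Y ≈ e + d + f`, which follows from `X + Y ≈ 0#` and `d * X ≈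
    -- 1#`; the three differences add up to `x p - x q`.
    shuffle-step : ∀ {p q i j} M N → p ≢ i → p ≢ j → i ≢ j →
      inv p i * ((x i - x q) * M * (inv i j * N)) + inv p j * ((x j - x q) * (inv j i * M) * N)
      ≈ (x p - x q) * (inv p i * M) * (inv p j * N)
    shuffle-step {p} {q} {i} {j} M N p≢i p≢j i≢j = begin
      A * ((x i - x q) * M * (X * N)) + B * (f * (Y * M) * N)
        ≈⟨ +-congʳ (*-congˡ (*-congʳ (*-congʳ (telescope i j q)))) ⟨
      A * ((d + f) * M * (X * N)) + B * (f * (Y * M) * N)
        -- Insert `(x p - x j) * inv p j` in the first summand and `(x p - x i) * inv p i` in the
        -- second, so that both contain `A * B`.
        ≈⟨ +-cong (*-congʳ (one (trans (*-congʳ (telescope p i j)) (x-inverse p≢j))))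
                  (*-congʳ (one (x-inverse p≢i))) ⟩
      A * ((e + d) * B) * ((d + f) * M * (X * N)) + B * (e * A) * (f * (Y * M) * N)
        ≈⟨ solve 9 (λ A B d e f X Y M N →
             A :* ((e :+ d) :* B) :* ((d :+ f) :* M :* (X :* N)) :+ B :* (e :* A) :* (f :* (Y :* M) :* N)
             := A :* M :* (B :* N) :* (e :* f :* (X :+ Y) :+ (e :+ (d :+ f)) :* (d :* X)))
             refl A B d e f X Y M N ⟩
      A * M * (B * N) * (e * f * (X + Y) + (e + (d + f)) * (d * X))
        ≈⟨ *-congˡ (+-cong (trans (*-congˡ (inv-antisym i≢j)) (zeroʳ _))
                           (trans (*-congˡ (x-inverse i≢j)) (*-identityʳ _))) ⟩
      A * M * (B * N) * (0# + (e + (d + f)))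
        ≈⟨ *-congˡ (trans (+-identityˡ _) (trans (+-congˡ (telescope i j q)) (telescope p i q))) ⟩
      A * M * (B * N) * (x p - x q)
        ≈⟨ solve 3 (λ a b c → a :* b :* c := c :* a :* b) refl _ _ _ ⟩
      (x p - x q) * (A * M) * (B * N) ∎
      where
      A = inv p i ; B = inv p j ; X = inv i j ; Y = inv j i
      d = x i - x j ; e = x p - x i ; f = x j - x q
      one : ∀ {a b} → b ≈ 1# → a ≈ a * b
      one {a} b≈1 = trans (sym (*-identityʳ a)) (*-congˡ (sym b≈1))

    sum-chain-∷ : ∀ p i q uss →
      sum (λ us → chain p us q) (map (i ∷_) uss) ≈ inv p i * sum (λ us → chain i us q) uss
    sum-chain-∷ p i q uss =
      trans (reflexive (sum-map (λ us → chain p us q) (i ∷_) uss))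
            (sum-*ˡ (λ us → chain i us q) (inv p i) uss)

    -- Sort the shuffles by first letter, apply induction to the remainders and combine by
    -- `shuffle-step`. An empty side needs `(x p - x q) * inv p q ≈ 1#`, so `p ≢ q` is demanded only
    -- then. With both sides nonempty, `p` and `q` may coincide: the recursive calls start from a
    -- letter different from `q`.
    sum-shuffles : ∀ {p q} is js → (is ≡ [] ⊎ js ≡ [] → p ≢ q) →
      Unique (p ∷ is) → Unique (p ∷ js) → All (λ i → All (i ≢_) js) is →
      All (_≢ q) is → All (_≢ q) js →
      sum (λ us → chain p us q) (shuffles is js) ≈ (x p - x q) * chain p is q * chain p js q
    sum-shuffles [] js p≢q _ _ _ _ _ =
      trans (+-identityʳ _) (sym (trans (*-congʳ (x-inverse (p≢q (inj₁ ≡.refl)))) (*-identityˡ _)))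
    sum-shuffles {p} {q} is@(i ∷ is′) [] p≢q _ _ _ _ _ = trans (+-identityʳ _) (begin
      c                                 ≈⟨ *-identityˡ _ ⟨
      1# * c                            ≈⟨ *-congʳ (x-inverse (p≢q (inj₂ ≡.refl))) ⟨
      (x p - x q) * inv p q * c         ≈⟨ solve 3 (λ a b c → a :* b :* c := a :* c :* b) refl _ _ _ ⟩
      (x p - x q) * c * inv p q         ∎)
      where c = chain p is q
    sum-shuffles {p} {q} (i ∷ is) (j ∷ js) _
      ((p≢i ∷ p≢is) ∷ ui@(_ ∷ uis)) ((p≢j ∷ p≢js) ∷ uj@(_ ∷ ujs)) ((i≢j ∷ i≢js) ∷ ds)
      (i≢q ∷ is≢q) (j≢q ∷ js≢q) = begin
      sum ch (map (i ∷_) sᵢ ++ map (j ∷_) sⱼ)             ≈⟨ sum-++ ch (map (i ∷_) sᵢ) _ ⟩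
      sum ch (map (i ∷_) sᵢ) + sum ch (map (j ∷_) sⱼ)
        ≈⟨ +-cong (sum-chain-∷ p i q sᵢ) (sum-chain-∷ p j q sⱼ) ⟩
      inv p i * sum (λ us → chain i us q) sᵢ + inv p j * sum (λ us → chain j us q) sⱼ
        ≈⟨ +-cong
            (*-congˡ (sum-shuffles is (j ∷ js) (λ _ → i≢q) ui ((i≢j ∷ i≢js) ∷ uj) ds is≢q (j≢q ∷ js≢q)))
            (*-congˡ (sum-shuffles (i ∷ is) js (λ _ → j≢q)
              (((i≢j ∘ ≡.sym) ∷ All.map (λ where (h ∷ _) e → h (≡.sym e)) ds) ∷ ui) uj
              (i≢js ∷ All.map (λ where (_ ∷ hs) → hs) ds) (i≢q ∷ is≢q) js≢q)) ⟩
      inv p i * ((x i - x q) * chain i is q * (inv i j * chain j js q)) +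
        inv p j * ((x j - x q) * (inv j i * chain i is q) * chain j js q)
        ≈⟨ shuffle-step _ _ p≢i p≢j i≢j ⟩
      (x p - x q) * (inv p i * chain i is q) * (inv p j * chain j js q) ∎
      where
      ch = λ us → chain p us q
      sᵢ = shuffles is (j ∷ js)
      sⱼ = shuffles (i ∷ is) js

    chain-++ : ∀ p is i q → chain p (is ++ i ∷ []) q ≈ chain p is i * inv i q
    chain-++ p []       i q = refl
    chain-++ p (j ∷ is) i q = trans (*-congˡ (chain-++ j is i q)) (sym (*-assoc _ _ _))

-- Residues modulo 1

⟦_⟧ : ℤ → ℚ
⟦ k ⟧ = k ℚ./ 1


⟦⟧-+ : ∀ k l → ⟦ k ℤ.+ l ⟧ ≡ ⟦ k ⟧ ℚ.+ ⟦ l ⟧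
⟦⟧-+ k l = ℚ.toℚᵘ-injective (begin
  ℚ.toℚᵘ ⟦ k ℤ.+ l ⟧                       ≈⟨ ℚ.toℚᵘ-fromℚᵘ (ℚᵘ.mkℚᵘ (k ℤ.+ l) 0) ⟩
  ℚᵘ.mkℚᵘ (k ℤ.+ l) 0
    ≈⟨ ℚᵘ.*≡* (≡.cong (ℤ._* ℤ.+ 1) (≡.sym (≡.cong₂ ℤ._+_ (ℤ.*-identityʳ k) (ℤ.*-identityʳ l)))) ⟩
  ℚᵘ.mkℚᵘ k 0 ℚᵘ.+ ℚᵘ.mkℚᵘ l 0
    ≈⟨ ℚᵘ.+-cong (ℚ.toℚᵘ-fromℚᵘ (ℚᵘ.mkℚᵘ k 0)) (ℚ.toℚᵘ-fromℚᵘ (ℚᵘ.mkℚᵘ l 0)) ⟨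
  ℚ.toℚᵘ ⟦ k ⟧ ℚᵘ.+ ℚ.toℚᵘ ⟦ l ⟧           ≈⟨ ℚ.toℚᵘ-homo-+ ⟦ k ⟧ ⟦ l ⟧ ⟨
  ℚ.toℚᵘ (⟦ k ⟧ ℚ.+ ⟦ l ⟧)                 ∎)
  where open ℚᵘ.≃-Reasoning

1≤⟦1+m⟧ : ∀ m → 1ℚ ℚ.≤ ⟦ ℤ.+ suc m ⟧
1≤⟦1+m⟧ m = begin
  1ℚ                   ≡⟨ ℚ.+-identityʳ 1ℚ ⟨
  1ℚ ℚ.+ 0ℚ            ≤⟨ ℚ.+-monoʳ-≤ 1ℚ (ℚ.nonNegative⁻¹ ⟦ ℤ.+ m ⟧ {{ℚ.normalize-nonNeg m 1}}) ⟩
  1ℚ ℚ.+ ⟦ ℤ.+ m ⟧       ≡⟨ ⟦⟧-+ (ℤ.+ 1) (ℤ.+ m) ⟨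
  ⟦ ℤ.+ suc m ⟧          ∎
  where open ℚ.≤-Reasoning

shift-cancel : ∀ q k → q ℚ.+ ⟦ ℤ.- k ⟧ ℚ.+ ⟦ k ⟧ ≡ q
shift-cancel q k = begin
  q ℚ.+ ⟦ ℤ.- k ⟧ ℚ.+ ⟦ k ⟧    ≡⟨ ℚ.+-assoc q _ _ ⟩
  q ℚ.+ (⟦ ℤ.- k ⟧ ℚ.+ ⟦ k ⟧)  ≡⟨ ≡.cong (q ℚ.+_) (⟦⟧-+ (ℤ.- k) k) ⟨
  q ℚ.+ ⟦ ℤ.- k ℤ.+ k ⟧        ≡⟨ ≡.cong (λ l → q ℚ.+ ⟦ l ⟧) (ℤ.+-inverseˡ k) ⟩
  q ℚ.+ 0ℚ                     ≡⟨ ℚ.+-identityʳ q ⟩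
  q                            ∎
  where open ≡.≡-Reasoning

Lower-≡ : ∀ x {p q} → p ≡ q → Lower x p ⇔ Lower x q
Lower-≡ x ≡.refl = ⇔.refl

≈ᴿ-sym : ∀ {x y} → x ≈ᴿ y → y ≈ᴿ x
≈ᴿ-sym e q = ⇔.sym (e q)

≈ᴿ⇒≡ℤ : ∀ {x y} → x ≈ᴿ y → x ≡ℤ y
≈ᴿ⇒≡ℤ {x} e = ℤ.+ 0 , λ q → ⇔.trans (Lower-≡ x (ℚ.+-identityʳ q)) (e q)

≡ℤ-sym : ∀ {x y} → x ≡ℤ y → y ≡ℤ x
≡ℤ-sym {x} (k , e) = ℤ.- k , λ q →
  ⇔.trans (⇔.sym (e (q ℚ.+ ⟦ ℤ.- k ⟧))) (Lower-≡ x (shift-cancel q k))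

≡ℤ-trans : ∀ {x y z} → x ≡ℤ y → y ≡ℤ z → x ≡ℤ z
≡ℤ-trans {x} (k , e) (l , f) = l ℤ.+ k , λ q →
  ⇔.trans (Lower-≡ x (≡.trans (≡.cong (q ℚ.+_) (⟦⟧-+ l k)) (≡.sym (ℚ.+-assoc q _ _))))
  (⇔.trans (e (q ℚ.+ ⟦ l ⟧)) (f q))

Lower-downward : ∀ x {p q} → p ℚ.< q → Lower x q → Lower x p
Lower-downward x {p} {q} p<q l = from (lower-rounded x p) (q , p<q , l)

0≤⇒Lower : ∀ {x q} → fromℚ 0ℚ ≤ᴿ x → q ℚ.< 0ℚ → Lower x q
0≤⇒Lower {x} {q} 0≤x q<0 with r , q<r , r<0 ← ℚ.<-dense q<0 with located x q r q<r
... | inj₁ l = l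
... | inj₂ u = contradiction (r , u , r<0) 0≤x

-- `≈ᴿ` compares lower cuts only. Round the upper bound down to `r` and locate `y` between `r` and
-- `q`: if `r` were below `y`, it would be both below and above `x`.
Upper-resp : ∀ {x y q} → x ≈ᴿ y → Upper x q → Upper y q
Upper-resp {x} {y} {q} e u with r , r<q , u′ ← to (upper-rounded x q) u with located y r q r<q
... | inj₁ l  = contradiction (from (e r) l , u′) (disjoint x r)
... | inj₂ u″ = u″

<ᴿ-resp : ∀ {x x′ y y′} → x ≈ᴿ x′ → y ≈ᴿ y′ → x <ᴿ y → x′ <ᴿ y′
<ᴿ-resp {x} {x′} e f (q , u , l) = q , Upper-resp {x} {x′} e u , to (f q) l

<ᴿ-irrefl : ∀ {x} → ¬ (x <ᴿ x)
<ᴿ-irrefl {x} (q , u , l) = disjoint x q (l , u)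

<ᴿ-trans : ∀ {x y z} → x <ᴿ y → y <ᴿ z → x <ᴿ z
<ᴿ-trans {x} {y} {z} (p , u , l) (q , u′ , l′) with ℚ.<-cmp p q
... | tri< p<q _ _    = p , u , Lower-downward z p<q l′
... | tri≈ _ ≡.refl _ = p , u , l′
... | tri> _ _ q<p    = contradiction (Lower-downward y q<p l , u′) (disjoint y q)

fromℚ-< : ∀ {p q} → p ℚ.< q → fromℚ p <ᴿ fromℚ q
fromℚ-< = ℚ.<-dense

-- A rational `p < 1` above `x` becomes negative once the shift is subtracted, hence lies below `y`;
-- shifting back puts `p` below `x` as well.
residues-not-shifted : ∀ {x y} m → x <ᴿ fromℚ 1ℚ → fromℚ 0ℚ ≤ᴿ y →
  ¬ (∀ q → Lower x (q ℚ.+ ⟦ ℤ.+ suc m ⟧) ⇔ Lower y q)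
residues-not-shifted {x} {y} m (p , u , p<1) 0≤y e = disjoint x p
  ( to (Lower-≡ x eq) (from (e (p ℚ.- s)) (0≤⇒Lower {y} 0≤y p-s<0)) , u)
  where
  s = ⟦ ℤ.+ suc m ⟧
  eq : p ℚ.- s ℚ.+ s ≡ p
  eq = ≡.trans (ℚ.+-assoc p _ _) (≡.trans (≡.cong (p ℚ.+_) (ℚ.+-inverseˡ s)) (ℚ.+-identityʳ p))
  p-s<0 : p ℚ.- s ℚ.< 0ℚ
  p-s<0 = ≡.subst (p ℚ.- s ℚ.<_) (ℚ.+-inverseʳ s)
            (ℚ.+-monoˡ-< (ℚ.- s) (ℚ.<-≤-trans p<1 (1≤⟦1+m⟧ m)))

-- Only the shift by zero is compatible with both bounds; swapping the two reals turns a negative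
-- shift into a positive one.
residue-unique : ∀ {x y} → fromℚ 0ℚ ≤ᴿ x → x <ᴿ fromℚ 1ℚ → fromℚ 0ℚ ≤ᴿ y → y <ᴿ fromℚ 1ℚ →
  x ≡ℤ y → x ≈ᴿ y
residue-unique {x} 0≤x x<1 0≤y y<1 (ℤ.+ zero , e) q =
  ⇔.trans (Lower-≡ x (≡.sym (ℚ.+-identityʳ q))) (e q)
residue-unique {x} {y} 0≤x x<1 0≤y y<1 (ℤ.+ suc m , e) =
  contradiction e (residues-not-shifted {x} {y} m x<1 0≤y)
residue-unique {x} {y} 0≤x x<1 0≤y y<1 (-[1+ m ] , e) =
  contradiction (proj₂ (≡ℤ-sym {x} {y} (-[1+ m ] , e))) (residues-not-shifted {y} {x} m y<1 0≤x)

-- Coordinates for a rational point in the chamber of an order: the vertex in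
-- position k is put at level k.
ascent : ℕ → ∃ λ q → q ℚ.< 1ℚ
ascent zero    = 0ℚ , ℚ.positive⁻¹ 1ℚ
ascent (suc k) = let q , _ , q<1 = ℚ.<-dense (proj₂ (ascent k)) in q , q<1

level : ℕ → ℚ
level = proj₁ ∘ ascent

level-suc : ∀ k → level k ℚ.< level (suc k)
level-suc k = proj₁ (proj₂ (ℚ.<-dense (proj₂ (ascent k))))

level-mono-≤ : ∀ {k l} → k ℕ.≤ l → level k ℚ.≤ level l
level-mono-≤ = go ∘ ℕ.≤⇒≤′
  where
  go : ∀ {k l} → k ℕ.≤′ l → level k ℚ.≤ level l
  go ℕ.≤′-refl     = ℚ.≤-refl
  go (ℕ.≤′-step {l} p) = ℚ.≤-trans (go p) (ℚ.<⇒≤ (level-suc l))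

level-mono-< : ∀ {k l} → k ℕ.< l → level k ℚ.< level l
level-mono-< {k} k<l = ℚ.<-≤-trans (level-suc k) (level-mono-≤ k<l)

level-<⇔ : ∀ {k l} → k ℕ.< l ⇔ fromℚ (level k) <ᴿ fromℚ (level l)
level-<⇔ {k} {l} = mk⇔ (fromℚ-< ∘ level-mono-<) λ (q , tk<q , q<tl) →
  ℕ.≰⇒> λ l≤k → ℚ.<-irrefl ≡.refl (ℚ.<-≤-trans (ℚ.<-trans tk<q q<tl) (level-mono-≤ l≤k))

-- Total orders and the orientations they induce

module _ {n : ℕ} where

  -- The length of the list when the vertex does not occur in it.
  position : List (Fin n) → Fin n → ℕ
  position []      i = 0
  position (j ∷ w) i with j Fin.≟ i
  ... | yes _ = 0
  ... | no  _ = suc (position w i)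

  position-head : ∀ i w → position (i ∷ w) i ≡ 0
  position-head i w with i Fin.≟ i
  ... | yes _   = ≡.refl
  ... | no  i≢i = contradiction ≡.refl i≢i

  position-tail : ∀ {i j} w → j ≢ i → position (j ∷ w) i ≡ suc (position w i)
  position-tail {i} {j} w j≢i with j Fin.≟ i
  ... | yes j≡i = contradiction j≡i j≢i
  ... | no  _   = ≡.refl

  position-tail-< : ∀ {i j k} w → k ≢ i → k ≢ j →
    (position w i < position w j) ⇔ (position (k ∷ w) i < position (k ∷ w) j)
  position-tail-< w k≢i k≢j rewrite position-tail w k≢i | position-tail w k≢j = mk⇔ s<s s<s⁻¹

  position-< : ∀ {w i} → i ∈ w → position w i < length w
  position-< {j ∷ w} {i} i∈ with j Fin.≟ i | i∈
  ... | yes _   | _          = z<s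
  ... | no  j≢i | here i≡j   = contradiction (≡.sym i≡j) j≢i
  ... | no  _   | there i∈w  = s<s (position-< i∈w)

  position-injective : ∀ {w i j} → i ∈ w → position w i ≡ position w j → i ≡ j
  position-injective {k ∷ w} {i} {j} i∈ eq with k Fin.≟ i | k Fin.≟ j | i∈
  ... | yes k≡i | yes k≡j | _         = ≡.trans (≡.sym k≡i) k≡j
  ... | no  k≢i | _       | here i≡k  = contradiction (≡.sym i≡k) k≢i
  ... | no  _   | no _    | there i∈w = position-injective i∈w (ℕ.suc-injective eq)

  position-∷ʳ-∈ : ∀ {w i} k → i ∈ w → position (w ∷ʳ k) i ≡ position w i
  position-∷ʳ-∈ {j ∷ w} {i} k i∈ with j Fin.≟ i | i∈
  ... | yes _   | _         = ≡.refl
  ... | no  j≢i | here i≡j  = contradiction (≡.sym i≡j) j≢i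
  ... | no  _   | there i∈w = ≡.cong suc (position-∷ʳ-∈ k i∈w)

  position-∷ʳ-∉ : ∀ {w k} → k ∉ w → position (w ∷ʳ k) k ≡ length w
  position-∷ʳ-∉ {[]}    {k} _  = position-head k []
  position-∷ʳ-∉ {j ∷ w} {k} k∉ = ≡.trans (position-tail (w ∷ʳ k) (k∉ ∘ here ∘ ≡.sym))
                                   (≡.cong suc (position-∷ʳ-∉ (k∉ ∘ there)))

  sorted⇒position-< : ∀ {w} → Unique w → Linked (λ i j → position w i < position w j) w
  sorted⇒position-< = AllPairs⇒Linked ∘ go
    where
    shift : ∀ {k w vs} → All (k ≢_) vs → AllPairs (λ i j → position w i < position w j) vs →
      AllPairs (λ i j → position (k ∷ w) i < position (k ∷ w) j) vs
    shift []          []       = []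
    shift {w = w} (k≢i ∷ k≢) (p ∷ ps) =
      All.zipWith (λ (k≢j , lt) → to (position-tail-< w k≢i k≢j) lt) (k≢ , p) ∷ shift k≢ ps
    go : ∀ {w} → Unique w → AllPairs (λ i j → position w i < position w j) w
    go []                        = []
    go {k ∷ w} (k≢ ∷ u) = All.map first k≢ ∷ shift k≢ (go u)
      where
      first : ∀ {j} → k ≢ j → position (k ∷ w) k < position (k ∷ w) j
      first k≢j rewrite position-head k w | position-tail w k≢j = z<s

  position-<⇒sorted : ∀ {R : Rel (Fin n) 0ℓ} → Transitive R → ∀ {w i j} → Linked R w →
    i ∈ w → j ∈ w → position w i < position w j → R i j
  position-<⇒sorted {R} R-trans = go ∘ Linked⇒AllPairs R-trans
    where
    go : ∀ {w i j} → AllPairs R w → i ∈ w → j ∈ w → position w i < position w j → R i j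
    go {k ∷ w} {i} {j} (r ∷ rs) i∈ j∈ i<j with k Fin.≟ i | k Fin.≟ j | i∈ | j∈
    ... | yes _      | no k≢j | _         | here j≡k  = contradiction (≡.sym j≡k) k≢j
    ... | yes ≡.refl | no _   | _         | there j∈w = All.lookup r j∈w
    ... | no k≢i     | no _   | here i≡k  | _         = contradiction (≡.sym i≡k) k≢i
    ... | no _       | no k≢j | there _   | here j≡k  = contradiction (≡.sym j≡k) k≢j
    ... | no _       | no _   | there i∈w | there j∈w = go rs i∈w j∈w (s<s⁻¹ i<j)

  rotate-↭ : ∀ (w : List (Fin n)) → rotate w ↭ w
  rotate-↭ []      = _↭_.refl
  rotate-↭ (i ∷ w) = ↭-sym (↭.∷↭∷ʳ i w)

  module _ {w : List (Fin n)} (w↭V : IsTotalOrder w) where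

    ∈-total : ∀ i → i ∈ w
    ∈-total i = ↭.∈-resp-↭ (↭-sym w↭V) (∈-allFin i)

    unique-total : Unique w
    unique-total = ↭ₛ.Unique-resp-↭ (≡.setoid _) (↭⇒↭ₛ (↭-sym w↭V)) (allFin⁺ n)

  module _ {Q Q′ : Quiver n} (e : ∀ i j → Arc Q i j ⇔ Arc Q′ i j) where

    FlippedArc-cong : ∀ k i j → FlippedArc Q k i j ⇔ FlippedArc Q′ k i j
    FlippedArc-cong k i j with i Fin.≟ k | j Fin.≟ k
    ... | yes _ | _     = e j i
    ... | no  _ | yes _ = e j i
    ... | no  _ | no  _ = e i j

    Flip-resp : ∀ {k Q″} → Flip Q′ k Q″ → Flip Q k Q″
    Flip-resp {k} (s , f) =
      Sum.map (λ h j → h j ∘ to (e j k)) (λ h j → h j ∘ to (e k j)) s ,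
      λ i j → ⇔.trans (f i j) (⇔.sym (FlippedArc-cong k i j))

  ∼-trans : ∀ {Q Q′ Q″ : Quiver n} → Q ∼ Q′ → Q′ ∼ Q″ → Q ∼ Q″
  ∼-trans (done e)     (done f)                = done λ i j → ⇔.trans (e i j) (f i j)
  -- `done` can only end a sequence of flips, so an equivalence of arcs preceding a flip is absorbed
  -- into that flip.
  ∼-trans {Q} {Q′} (done e) (flip {Q′ = R} k f s) = flip k (Flip-resp {Q} {Q′} e {Q″ = R} f) s
  ∼-trans (flip k f s) s′                      = flip k f (∼-trans s s′)

  Edge-sym : ∀ (Q : Quiver n) {i j} → Edge Q i j → Edge Q j i
  Edge-sym Q = Sum.swap

  Edge-irrefl : ∀ (Q : Quiver n) {i j} → Edge Q i j → i ≢ j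
  Edge-irrefl Q {i} (inj₁ a) ≡.refl = acyclic Q i [ a ]
  Edge-irrefl Q {i} (inj₂ a) ≡.refl = acyclic Q i [ a ]

module _ {n : ℕ} (Q : Quiver n) where

  -- The acyclic orientation of the underlying graph induced by `w`. Positions strictly increase
  -- along paths, which rules out cycles.
  orient : List (Fin n) → Quiver n
  orient w = record
    { Arc     = λ i j → Edge Q i j × position w i < position w j
    ; arc?    = λ i j → edge? i j ×-dec (position w i ℕ.<? position w j)
    ; acyclic = λ i c → ℕ.<-irrefl ≡.refl (increases c)
    }
    where
    edge? : ∀ i j → _
    edge? i j = arc? Q i j ⊎-dec arc? Q j i
    increases : ∀ {i j} → TransClosure (λ i j → Edge Q i j × position w i < position w j) i j →
      position w i < position w j
    increases [ _ , lt ]       = lt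
    increases ((_ , lt) ∷ ltₛ) = ℕ.<-trans lt (increases ltₛ)

  -- The first vertex is a source, and moving it to the end turns it into a sink without changing
  -- the order of the others: one rotation is one flip.
  orient-rotate : ∀ {w} → IsTotalOrder w → orient w ∼ orient (rotate w)
  orient-rotate {[]}    _   = done λ _ _ → ⇔.refl
  orient-rotate {k ∷ u} w↭V = flip {Q′ = orient (u ∷ʳ k)} k (inj₁ source , arcs) (done λ _ _ → ⇔.refl)
    where
    k∉u : k ∉ u
    k∉u = Unique[x∷xs]⇒x∉xs (unique-total w↭V)

    ∈u : ∀ {i} → i ≢ k → i ∈ u
    ∈u {i} i≢k with ∈-total w↭V i
    ... | here i≡k  = contradiction i≡k i≢k
    ... | there i∈u = i∈u

    ¬<k : ∀ {j} → ¬ (position (k ∷ u) j < position (k ∷ u) k)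
    ¬<k rewrite position-head k u = λ ()

    k<_ : ∀ {j} → j ≢ k → position (k ∷ u) k < position (k ∷ u) j
    k< j≢k rewrite position-head k u | position-tail u (j≢k ∘ ≡.sym) = z<s

    _<k : ∀ {j} → j ≢ k → position (u ∷ʳ k) j < position (u ∷ʳ k) k
    j≢k <k rewrite position-∷ʳ-∉ k∉u | position-∷ʳ-∈ k (∈u j≢k) = position-< (∈u j≢k)

    source : IsSource (orient (k ∷ u)) k
    source j (_ , lt) = ¬<k lt

    arcs : ∀ i j → (Edge Q i j × position (u ∷ʳ k) i < position (u ∷ʳ k) j) ⇔
                   FlippedArc (orient (k ∷ u)) k i j
    arcs i j with i Fin.≟ k | j Fin.≟ k
    ... | yes ≡.refl | yes ≡.refl = mk⇔ (λ (e , lt) → Edge-sym Q e , contradiction lt (ℕ.<-irrefl ≡.refl))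
                                        (λ (e , lt) → contradiction lt ¬<k)
    ... | yes ≡.refl | no  j≢k    = mk⇔ (λ (e , lt) → contradiction lt (ℕ.<-asym (j≢k <k)))
                                        (λ (e , lt) → contradiction lt ¬<k)
    ... | no  i≢k    | yes ≡.refl = mk⇔ (λ (e , _) → Edge-sym Q e , (k< i≢k))
                                        (λ (e , _) → Edge-sym Q e , (i≢k <k))
    ... | no  i≢k    | no  j≢k
      rewrite position-∷ʳ-∈ k (∈u i≢k) | position-∷ʳ-∈ k (∈u j≢k)
      = mk⇔ (Product.map₂ (to lt⇔)) (Product.map₂ (from lt⇔))
      where lt⇔ = position-tail-< u (i≢k ∘ ≡.sym) (j≢k ∘ ≡.sym)

  orient-↻ : ∀ {w w′} → IsTotalOrder w → w ↻ w′ → orient w ∼ orient w′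
  orient-↻ _   ε              = done λ _ _ → ⇔.refl
  orient-↻ {w} w↭V (≡.refl ◅ s) =
    ∼-trans (orient-rotate w↭V) (orient-↻ (↭-trans (rotate-↭ w) w↭V) s)

↻-↭ : ∀ {n} {w w′ : List (Fin n)} → w ↻ w′ → w′ ↭ w
↻-↭ ε            = _↭_.refl
↻-↭ {w = w} (≡.refl ◅ s) = ↭-trans (↻-↭ s) (rotate-↭ w)

-- Toric total extensions and induced orientations

module _ {n : ℕ} {Q : Quiver n} {w : List (Fin n)} where

  -- It suffices to test the inclusion of chambers at one point, whose coordinates are the levels of
  -- the positions in `w`. The orientation read off there is the one induced by `w`.
  extension⇒∼orient : IsToricTotalExtension Q w → Q ∼ orient Q w
  extension⇒∼orient (w↭V , ⊆chamber) =
    let _ , r , x-r , _ , Q∼Q′ , arcs = ⊆chamber x∈w in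
    -- `chamber` supplies residues `r` of its own; uniqueness identifies them with `x`, whose
    -- coordinates already lie in [0, 1).
    let x≈r = λ i → let open _mod1≡_ (x-r i) in
                residue-unique {x i} {r i} (0≤x i) (x<1 i) 0≤r r<1 x≡r
        <⇔ = λ i j → ⇔.trans (level-<⇔ {position w i} {position w j})
               (mk⇔ (<ᴿ-resp {x i} {r i} {x j} {r j} (x≈r i) (x≈r j))
                    (<ᴿ-resp {r i} {x i} {r j} {x j}
                       (≈ᴿ-sym {x i} {r i} (x≈r i)) (≈ᴿ-sym {x j} {r j} (x≈r j))))
    in ∼-trans Q∼Q′ (done λ i j → ⇔.trans (arcs i j)
         (mk⇔ (Product.map₂ (from (<⇔ i j))) (Product.map₂ (to (<⇔ i j)))))
    where
    x : Point n
    x i = fromℚ (level (position w i))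
    0≤x : ∀ i → fromℚ 0ℚ ≤ᴿ x i
    0≤x i (q , x<q , q<0) = ℚ.<-irrefl ≡.refl
      (ℚ.<-≤-trans (ℚ.<-trans x<q q<0) (level-mono-≤ {0} {position w i} z≤n))
    x<1 : ∀ i → x i <ᴿ fromℚ 1ℚ
    x<1 i = fromℚ-< (proj₂ (ascent (position w i)))
    x∈w : orderChamber w x
    x∈w = x , (λ i → record { 0≤r = 0≤x i ; r<1 = x<1 i ; x≡r = ≈ᴿ⇒≡ℤ {x i} {x i} λ _ → ⇔.refl }) ,
      w , ε , Linked.map (λ {i} {j} → to (level-<⇔ {position w i} {position w j}))
                (sorted⇒position-< (unique-total w↭V))

module _ {n : ℕ} {Q : Quiver n} where

  module _ {x r : Point n} (x-r : x HasResidues r) {w : List (Fin n)} (w↭V : IsTotalOrder w)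
           (sorted : Linked (λ i j → r i <ᴿ r j) w) where

    position-<⇒<ᴿ : ∀ {i j} → position w i < position w j → r i <ᴿ r j
    position-<⇒<ᴿ {i} {j} = position-<⇒sorted (λ {i} {j} {k} → <ᴿ-trans {r i} {r j} {r k}) sorted
                              (∈-total w↭V i) (∈-total w↭V j)

    <ᴿ⇒position-< : ∀ {i j} → i ≢ j → r i <ᴿ r j → position w i < position w j
    <ᴿ⇒position-< {i} {j} i≢j ri<rj = ℕ.≰⇒> λ pj≤pi → <ᴿ-irrefl {r i}
      (<ᴿ-trans {r i} {r j} {r i} ri<rj (position-<⇒<ᴿ (ℕ.≤∧≢⇒< pj≤pi
        (i≢j ∘ ≡.sym ∘ position-injective (∈-total w↭V j)))))

    residues-distinct : ∀ {i j} → i ≢ j → ¬ (r i ≈ᴿ r j)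
    residues-distinct {i} {j} i≢j ri≈rj with ℕ.<-cmp (position w i) (position w j)
    ... | tri< lt _ _ = <ᴿ-irrefl {r j}
      (<ᴿ-resp {r i} {r j} {r j} {r j} ri≈rj (λ _ → ⇔.refl) (position-<⇒<ᴿ lt))
    ... | tri≈ _ eq _ = i≢j (position-injective (∈-total w↭V i) eq)
    ... | tri> _ _ gt = <ᴿ-irrefl {r j}
      (<ᴿ-resp {r j} {r j} {r i} {r j} (λ _ → ⇔.refl) ri≈rj (position-<⇒<ᴿ gt))

    -- A representative `y` on a hyperplane gives two adjacent vertices congruent residues. Lying in
    -- [0, 1), these are equal, which contradicts the strict ordering.
    generic : ¬ 𝒜-tor (Edge Q) x
    generic (y , x≡y , i , j , e , yi≈yj) = residues-distinct (Edge-irrefl Q e)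
      (residue-unique {r i} {r j} (0≤r (x-r i)) (r<1 (x-r i)) (0≤r (x-r j)) (r<1 (x-r j))
        (≡ℤ-trans {r i} {x i} {r j} (≡ℤ-sym {x i} {r i} (x≡r (x-r i)))
        (≡ℤ-trans {x i} {y i} {r j} (x≡y i)
        (≡ℤ-trans {y i} {y j} {r j} (≈ᴿ⇒≡ℤ {y i} {y j} yi≈yj)
        (≡ℤ-trans {y j} {x j} {r j} (≡ℤ-sym {x j} {y j} (x≡y j)) (x≡r (x-r j)))))))
      where open _mod1≡_

  -- The residues of a point of `orderChamber w` increase along some rotation `w′` of `w`. Its
  -- orientation is therefore `orient Q w′`, which flips connect to `orient Q w`.
  ∼orient⇒extension : ∀ {w} → IsTotalOrder w → Q ∼ orient Q w → IsToricTotalExtension Q w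
  ∼orient⇒extension w↭V Q∼w = w↭V , λ {x} (r , x-r , w′ , w↻w′ , sorted) →
    let w′↭V = ↭-trans (↻-↭ w↻w′) w↭V in
    generic {x} {r} x-r w′↭V sorted ,
    r , x-r , orient Q w′ , ∼-trans Q∼w (orient-↻ Q w↭V w↻w′) ,
    λ i j → mk⇔
      (Product.map₂ (position-<⇒<ᴿ {x} {r} x-r w′↭V sorted))
      (λ (e , lt) → e , <ᴿ⇒position-< {x} {r} x-r w′↭V sorted (Edge-irrefl Q e) lt)

-- Rotations

module _ {n : ℕ} where

  ++⇒↻ : ∀ (as bs : List (Fin n)) → as ++ bs ↻ bs ++ as
  ++⇒↻ []       bs = ≡.subst (bs ↻_) (≡.sym (List.++-identityʳ bs)) ε
  ++⇒↻ (a ∷ as) bs = ≡.refl ◅ ≡.subst₂ _↻_ (≡.sym (List.++-assoc as bs (a ∷ [])))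
                                           (List.++-assoc bs (a ∷ []) as) (++⇒↻ as (bs ∷ʳ a))

  ↻⇒++ : ∀ {w w′ : List (Fin n)} → w ↻ w′ → ∃₂ λ as bs → w ≡ as ++ bs × w′ ≡ bs ++ as
  ↻⇒++ {w} s = go [] w ≡.refl (≡.sym (List.++-identityʳ w)) s
    where
    go : ∀ as bs {w₁ w′} → w ≡ as ++ bs → w₁ ≡ bs ++ as → w₁ ↻ w′ →
      ∃₂ λ as bs → w ≡ as ++ bs × w′ ≡ bs ++ as
    go as       bs       eq eq₁    ε            = as , bs , eq , eq₁
    go []       []       eq ≡.refl (≡.refl ◅ s) = go [] [] eq ≡.refl s
    -- All letters have been moved and the word is back at `w`; a new turn begins with its first
    -- letter.
    go (a ∷ as) []       eq ≡.refl (≡.refl ◅ s) =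
      go (a ∷ []) as (≡.trans eq (≡.cong (a ∷_) (List.++-identityʳ as))) ≡.refl s
    go as       (b ∷ bs) eq ≡.refl (≡.refl ◅ s) =
      go (as ∷ʳ b) bs (≡.trans eq (≡.sym (List.++-assoc as (b ∷ []) bs)))
         (List.++-assoc bs as (b ∷ [])) s

  -- `_↻_` is generated by rotations in one direction. Any composite of them exchanges a prefix with
  -- a suffix, and these can be exchanged back.
  ↻-sym : Symmetric (_↻_ {n})
  ↻-sym s with as , bs , ≡.refl , ≡.refl ← ↻⇒++ s = ++⇒↻ bs as

  -- The first letter fixes the rotation: a proper split would place `v` inside `u` as well as in
  -- front of it.
  ↻-tail-unique : ∀ {v : Fin n} {u u′} → Unique (v ∷ u) → v ∷ u ↻ v ∷ u′ → u ≡ u′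
  ↻-tail-unique {v} {u} {u′} uniq s with ↻⇒++ s
  ... | []     , bs     , eq , eq′ =
          List.∷-injectiveʳ (≡.trans eq (≡.trans (≡.sym (List.++-identityʳ bs)) (≡.sym eq′)))
  ... | a ∷ as , []     , eq , eq′ =
          List.∷-injectiveʳ (≡.trans eq (≡.trans (List.++-identityʳ (a ∷ as)) (≡.sym eq′)))
  ... | a ∷ as , b ∷ bs , eq , eq′ = contradiction
          (≡.subst₂ _∈_ (≡.sym (List.∷-injectiveˡ eq′)) (≡.sym (List.∷-injectiveʳ eq)) (∈-insert as))
          (Unique[x∷xs]⇒x∉xs uniq)

  ∈⇒↻ : ∀ {v : Fin n} {w} → v ∈ w → ∃ λ u → w ↻ v ∷ u
  ∈⇒↻ {v} v∈w with as , bs , ≡.refl ← ∈-∃++ v∈w = bs ++ as , ++⇒↻ as (v ∷ bs)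

  extension-↻ : ∀ {Q : Quiver n} {w w′} → IsToricTotalExtension Q w → w ↻ w′ →
    IsToricTotalExtension Q w′
  extension-↻ (w↭V , ⊆c) s =
    ↭-trans (↻-↭ s) w↭V , λ (r , x-r , w″ , s′ , sorted) → ⊆c (r , x-r , w″ , s ◅◅ s′ , sorted)

-- Relative order within the two sides

module _ {n : ℕ} {P : Pred (Fin n) 0ℓ} (P? : Decidable P) where

  position-filter : ∀ u {i j} → P i → P j →
    position (filter P? u) i < position (filter P? u) j ⇔ position u i < position u j
  position-filter []      pi pj = ⇔.refl
  position-filter (k ∷ u) {i} {j} pi pj with P? k
  ... | no ¬pk = ⇔.trans (position-filter u pi pj)
                   (position-tail-< u (λ k≡i → ¬pk (≡.subst P (≡.sym k≡i) pi))
                                      (λ k≡j → ¬pk (≡.subst P (≡.sym k≡j) pj)))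
  ... | yes _ with k Fin.≟ i | k Fin.≟ j
  ...   | yes _ | yes _ = ⇔.refl
  ...   | yes _ | no  _ = mk⇔ (λ _ → z<s) (λ _ → z<s)
  ...   | no  _ | yes _ = mk⇔ (λ ()) (λ ())
  ...   | no  _ | no  _ = mk⇔ (s<s ∘ to ih ∘ s<s⁻¹) (s<s ∘ from ih ∘ s<s⁻¹)
    where ih = position-filter u pi pj

  position-filter-≡ : ∀ u u′ {i j} → filter P? u′ ≡ filter P? u → P i → P j →
    position u i < position u j ⇔ position u′ i < position u′ j
  position-filter-≡ u u′ {i} {j} eq pi pj = ⇔.trans (⇔.sym (position-filter u pi pj))
    (≡.subst (λ vs → position vs i < position vs j ⇔ _) eq (position-filter u′ pi pj))

module _ {n : ℕ} {P : Pred (Fin n) 0ℓ} (P? : Decidable P) where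

  filter-↭ : ∀ u → u ↭ filter P? u ++ filter (∁? P?) u
  filter-↭ []      = ↭-refl
  filter-↭ (k ∷ u) with P? k
  ... | yes _ = prep k (filter-↭ u)
  ... | no  _ = ↭-trans (prep k (filter-↭ u)) (↭-sym (↭.shift k (filter P? u) _))

  filters : List (Fin n) → List (Fin n) × List (Fin n)
  filters u = filter P? u , filter (∁? P?) u

  filters-↭ : ∀ {u u′} → filters u′ ≡ filters u → u′ ↭ u
  filters-↭ {u} {u′} eq = ↭-trans (filter-↭ u′)
    (↭-trans (↭-reflexive (≡.cong₂ _++_ (,-injectiveˡ eq) (,-injectiveʳ eq))) (↭-sym (filter-↭ u)))

  -- Both vertices satisfy the same one of the two complementary predicates, and filtering by it
  -- preserves their relative order.
  filters-position : ∀ {u u′ i j} → filters u′ ≡ filters u → (P i ⇔ P j) →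
    position u i < position u j ⇔ position u′ i < position u′ j
  filters-position {u} {u′} {i} eq same with P? i
  ... | yes pi = position-filter-≡ P? u u′ (,-injectiveˡ eq) pi (to same pi)
  ... | no ¬pi = position-filter-≡ (∁? P?) u u′ (,-injectiveʳ eq) ¬pi (¬pi ∘ from same)

-- Separations

-- A partition of `S` without edges across it, decidable so that lists can be filtered. The
-- witnesses `a` and `b` keep both sides nonempty, as the shuffle identity requires when the two
-- ends of the chain coincide.
record Separation {n : ℕ} (E : Rel (Fin n) 0ℓ) (S : Pred (Fin n) 0ℓ) : Set₁ where
  field
    Side      : Pred (Fin n) 0ℓ
    side?     : Decidable Side
    separated : ∀ {i j} → S i → S j → E i j → Side i ⇔ Side j
    a b       : Fin n
    a∈S       : S a
    b∈S       : S b
    a∈Side    : Side a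
    b∉Side    : ¬ Side b

module _ {n : ℕ} {E : Rel (Fin n) 0ℓ} (E-sym : Symmetric E) where

  -- One side is the component of the first representative. Membership is decidable because
  -- `complete` names a representative reached by a given vertex of `S`, and `distinct` forbids
  -- reaching two.
  component-separation : ∀ {S} → Decidable S → (C : Components E S) → 2 ≤ size C → Separation E S
  component-separation _ record { representatives = [] } ()
  component-separation _ record { representatives = _ ∷ [] } (s≤s ())
  component-separation {S} S? record
    { representatives = r₀ ∷ r₁ ∷ rs ; sound = r₀∈S ∷ r₁∈S ∷ _
    ; distinct = r₀≁ ∷ _ ; complete = complete } _ = record
    { Side      = _⇝ r₀
    ; side?     = side?
    ; separated = λ i∈S j∈S e → mk⇔ ((j∈S , i∈S , E-sym e) ◅_) ((i∈S , j∈S , e) ◅_)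
    ; a∈S       = r₀∈S
    ; b∈S       = r₁∈S
    ; a∈Side    = ε
    ; b∉Side    = λ r₁⇝r₀ → All.head r₀≁ (⇝-sym r₁⇝r₀)
    }
    where
    _⇝_ = Star (Induced E S)
    ⇝-sym : Symmetric _⇝_
    ⇝-sym = Star.reverse λ (i∈S , j∈S , e) → j∈S , i∈S , E-sym e
    side? : Decidable (_⇝ r₀)
    side? i with S? i
    ... | no i∉S = no λ where
      ε                   → i∉S r₀∈S
      ((i∈S , _) ◅ _)     → i∉S i∈S
    ... | yes i∈S with complete i∈S
    ...   | here i⇝r₀   = yes i⇝r₀
    ...   | there i⇝rs  = no λ i⇝r₀ → All.All¬⇒¬Any r₀≁
                            (Any.map (⇝-sym i⇝r₀ ◅◅_) i⇝rs)

  -- The whole graph has at least one component, since `v` is a vertex, so deleting `v` leaves at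
  -- least two.
  cut-separation : ∀ {v} → IsCutVertex E v → Separation E (_≢ v)
  cut-separation {v} (C , C′ , C<C′) = component-separation (λ i → ¬? (i Fin.≟ v)) C′
    (ℕ.≤-trans (s≤s (nonempty C)) C<C′)
    where
    nonempty : (C : Components E U) → 1 ≤ size C
    nonempty C with representatives C | complete C {v} _
    ... | _ ∷ _ | _ = s≤s z≤n

  third : ∀ {n} → 3 ≤ n → (a b : Fin n) → ∃ λ v → a ≢ v × b ≢ v
  third (s≤s (s≤s (s≤s _))) zero          zero          = suc zero , (λ ()) , (λ ())
  third (s≤s (s≤s (s≤s _))) zero          (suc zero)    = suc (suc zero) , (λ ()) , (λ ())
  third (s≤s (s≤s (s≤s _))) zero          (suc (suc _)) = suc zero , (λ ()) , (λ ())
  third (s≤s (s≤s (s≤s _))) (suc zero)    zero          = suc (suc zero) , (λ ()) , (λ ())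
  third (s≤s (s≤s (s≤s _))) (suc (suc _)) zero          = suc zero , (λ ()) , (λ ())
  third (s≤s (s≤s (s≤s _))) (suc _)       (suc _)       = zero , (λ ()) , (λ ())

  -- The vertex `v` is chosen away from both witnesses, so that each side stays nonempty without it;
  -- this is where three vertices are needed.
  disconnected-separation : 3 ≤ n → ¬ Connected E → Components E U → ∃ λ v → Separation E (_≢ v)
  disconnected-separation 3≤n ¬conn C =
    let sep = component-separation (λ _ → yes _) C 2≤size
        open Separation sep
        v , a≢v , b≢v = third 3≤n a b
    in v , record
      { Side = Side ; side? = side? ; separated = λ _ _ → separated _ _
      ; a∈S = a≢v ; b∈S = b≢v ; a∈Side = a∈Side ; b∉Side = b∉Side }
    where
    2≤size : 2 ≤ size C
    2≤size with representatives C | complete C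
    ... | []        | c = contradiction (λ i → λ _ → ⊥-any (c {i} _)) ¬conn
      where
      ⊥-any : ∀ {A : Set} {Q : Pred A 0ℓ} {B : Set} → Any Q [] → B
      ⊥-any ()
    ... | _ ∷ _ ∷ _ | _ = s≤s (s≤s z≤n)
    ... | r ∷ []    | c = contradiction
      (λ i j → Star.map (proj₂ ∘ proj₂) (i⇝r i ◅◅ ⇝-sym (i⇝r j))) ¬conn
      where
      i⇝r : ∀ i → Star (Induced E U) i r
      i⇝r i with here p ← c {i} _ = p
      ⇝-sym : Symmetric (Star (Induced E U))
      ⇝-sym = Star.reverse λ (i∈S , j∈S , e) → j∈S , i∈S , E-sym e

-- Rational functions

module _ (D : IntegralDomain) where
  open IntegralDomain D using (_≈_; _≟0; 0#; 1#; 1≉0; *-congʳ; *-identityʳ; zeroˡ; trans; sym)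
  open FractionField D

  1≄0 : ¬ (embed 1# ≃ embed 0#)
  1≄0 (cross e) = 1≉0 (trans (sym (*-identityʳ 1#)) (trans e (zeroˡ 1#)))

  embed-injective : ∀ {a b} → embed a ≃ embed b → a ≈ b
  embed-injective (cross e) = trans (sym (*-identityʳ _)) (trans e (*-identityʳ _))

  -- Whether a fraction vanishes is decided by its numerator. This permits classical existence
  -- statements in proving that `Ψ-tor` vanishes.
  ≃0-stable : ∀ f → ¬ ¬ (f ≃ embed 0#) → f ≃ embed 0#
  ≃0-stable (a / b [ _ ]) ¬¬f≃0 with a ≟0
  ... | yes a≈0 = cross (trans (*-identityʳ a) (trans a≈0 (sym (zeroˡ b))))
  ... | no  a≉0 = contradiction
    (λ (cross e) → a≉0 (trans (sym (*-identityʳ a)) (trans e (zeroˡ b)))) ¬¬f≃0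

-- The outermost variable has degree-one coefficient 1, every other one has 0 there; two variables
-- of the coefficient ring are compared through their constant coefficients.
indeterminate-injective : ∀ {n} (i j : Fin n) →
  IntegralDomain._≈_ (ℚ[x] n) (indeterminate i) (indeterminate j) → i ≡ j
indeterminate-injective zero    zero    _ = ≡.refl
indeterminate-injective {suc n} zero    (suc j) e =
  contradiction (Polynomial._≋_.coeff-≈ e 1) (IntegralDomain.1≉0 (ℚ[x] n))
indeterminate-injective {suc n} (suc i) zero    e =
  contradiction (IntegralDomain.sym (ℚ[x] n) (Polynomial._≋_.coeff-≈ e 1)) (IntegralDomain.1≉0 (ℚ[x] n))
indeterminate-injective (suc i) (suc j) e =
  ≡.cong suc (indeterminate-injective i j (Polynomial._≋_.coeff-≈ e 0))

module _ {n : ℕ} where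
  open CommutativeRing (ℚ⟨x⟩ n)
  open FractionField (ℚ[x] n) using (_⁻¹; ⁻¹-inverseʳ)
  open RingProperties ring using (x∙y⁻¹≈ε⇒x≈y)
  open Sums (ℚ⟨x⟩ n)
  open SetoidReasoning setoid

  inv : Fin n → Fin n → Carrier
  inv i j = (x[ i ] - x[ j ]) ⁻¹

  inv-inverse : ∀ {i j} → i ≢ j → (x[ i ] - x[ j ]) * inv i j ≈ 1#
  inv-inverse {i} {j} i≢j = ⁻¹-inverseʳ (x[ i ] - x[ j ]) λ e →
    i≢j (indeterminate-injective i j (embed-injective (ℚ[x] n) (x∙y⁻¹≈ε⇒x≈y x[ i ] x[ j ] e)))

  open CyclicProducts x[_] inv inv-inverse

  -- `Ψ-order` inverts the whole product at once; here the factors are inverted separately, the form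
  -- to which the shuffle identity applies.
  cycle : List (Fin n) → Carrier
  cycle []      = 1#
  cycle (i ∷ w) = chain i w i

  cycle-rotate : ∀ w → cycle (rotate w) ≈ cycle w
  cycle-rotate []          = refl
  cycle-rotate (i ∷ [])    = refl
  cycle-rotate (i ∷ j ∷ w) = trans (chain-++ j w i j) (*-comm (chain j w i) (inv i j))

  cycle-↻ : ∀ {w w′} → w ↻ w′ → cycle w ≈ cycle w′
  cycle-↻ ε                    = refl
  cycle-↻ {w} (≡.refl ◅ s) = trans (sym (cycle-rotate w)) (cycle-↻ s)

  -- Only `i ≢ j` is assumed, so `p` may equal `i`: this is the first factor of a cycle, where the
  -- closing vertex is also the starting one.
  differences-chain-∷ : ∀ {p i j} w → i ≢ j → differences p j w * chain j w p ≈ 1# →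
    differences p i (j ∷ w) * chain i (j ∷ w) p ≈ 1#
  differences-chain-∷ {p} {i} {j} w i≢j e = begin
    (d * D) * (inv i j * C)  ≈⟨ interchange d D (inv i j) C ⟩
    (d * inv i j) * (D * C)  ≈⟨ *-cong (inv-inverse i≢j) e ⟩
    1# * 1#                  ≈⟨ *-identityʳ 1# ⟩
    1#                       ∎
    where
    open FractionIdentities (ℚ⟨x⟩ n) using (interchange)
    d = x[ i ] - x[ j ]
    D = differences p j w
    C = chain j w p

  differences-chain : ∀ {p i w} → All (p ≢_) (i ∷ w) → Unique (i ∷ w) →
    differences p i w * chain i w p ≈ 1#
  differences-chain {w = []}    (p≢i ∷ _) _ = inv-inverse (p≢i ∘ ≡.sym)
  differences-chain {w = j ∷ w} (_ ∷ p≢) ((i≢j ∷ _) ∷ u) =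
    differences-chain-∷ w i≢j (differences-chain p≢ u)

  inverse-unique : ∀ {f g} → f * g ≈ 1# → f ⁻¹ ≈ g
  inverse-unique {f} {g} fg≈1 = begin
    f ⁻¹             ≈⟨ *-identityʳ (f ⁻¹) ⟨
    f ⁻¹ * 1#        ≈⟨ *-congˡ {f ⁻¹} fg≈1 ⟨
    f ⁻¹ * (f * g)   ≈⟨ *-assoc (f ⁻¹) f g ⟨
    f ⁻¹ * f * g     ≈⟨ *-congʳ {g} (trans (*-comm (f ⁻¹) f) (⁻¹-inverseʳ f f≄0)) ⟩
    1# * g           ≈⟨ *-identityˡ g ⟩
    g                ∎
    where
    f≄0 : ¬ (f ≈ 0#)
    f≄0 f≈0 = 1≄0 (ℚ[x] n) (trans (sym fg≈1) (trans (*-congʳ {g} f≈0) (zeroˡ g)))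

  Ψ-order≈cycle : ∀ {w} → Unique w → 2 ≤ length w → Ψ-order w ≈ cycle w
  Ψ-order≈cycle {i ∷ j ∷ w} (i≢ ∷ u) _ =
    inverse-unique {differences i i (j ∷ w)} {cycle (i ∷ j ∷ w)}
      (differences-chain-∷ w (All.head i≢) (differences-chain i≢ u))
  Ψ-order≈cycle {_ ∷ []} _ (s≤s ())

  module _ {P : Pred (Fin n) 0ℓ} (P? : Decidable P) where

    -- With both ends of the chains equal to `v`, the factor `x p - x q` in `sum-shuffles` is zero.
    sum-fibre : ∀ {v u a b} → Unique (v ∷ u) → a ∈ u → b ∈ u → P a → ¬ P b →
      sum (λ us → cycle (v ∷ us)) (shuffles (filter P? u) (filter (∁? P?) u)) ≈ 0#
    sum-fibre {v} {u} {a} {b} (v≢u ∷ uniq) a∈u b∈u pa ¬pb = begin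
      sum (λ us → chain v us v) (shuffles is js)
        ≈⟨ sum-shuffles is js nonempty
             (All.filter⁺ P? v≢u ∷ filter⁺ P? uniq) (All.filter⁺ (∁? P?) v≢u ∷ filter⁺ (∁? P?) uniq)
             (All.map (λ pi → All.map (λ ¬pj i≡j → ¬pj (≡.subst P i≡j pi)) (All.all-filter (∁? P?) u))
                      (All.all-filter P? u))
             (All.map (_∘ ≡.sym) (All.filter⁺ P? v≢u))
             (All.map (_∘ ≡.sym) (All.filter⁺ (∁? P?) v≢u)) ⟩
      (x[ v ] - x[ v ]) * chain v is v * chain v js v
        ≈⟨ *-congʳ {chain v js v} (trans (*-congʳ {chain v is v} (-‿inverseʳ x[ v ]))
                                        (zeroˡ (chain v is v))) ⟩
      0# * chain v js v ≈⟨ zeroˡ (chain v js v) ⟩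
      0# ∎
      where
      is = filter P? u
      js = filter (∁? P?) u
      -- As `v ≢ v` is absurd, this amounts to neither side being empty, which `a` and `b` witness.
      nonempty : is ≡ [] ⊎ js ≡ [] → v ≢ v
      nonempty (inj₁ is≡[]) with () ← ≡.subst (a ∈_) is≡[] (∈-filter⁺ P? a∈u pa)
      nonempty (inj₂ js≡[]) with () ← ≡.subst (b ∈_) js≡[] (∈-filter⁺ (∁? P?) b∈u ¬pb)

-- Summation over the extensions rotated to start with `v`

module _ {n : ℕ} (Q : Quiver n) (v : Fin n) (ℒ : ℒ-tor Q) where

  private
    Rotated : List (Fin n) → List (Fin n) → Set₁
    Rotated w u = IsToricTotalExtension Q w × w ↻ v ∷ u

    rotated : ∀ {ws} → All (IsToricTotalExtension Q) ws → ∃ (Pointwise Rotated ws)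
    rotated []       = [] , []
    rotated (e ∷ es) =
      let u , s = ∈⇒↻ (∈-total (proj₁ e) v) ; us , ps = rotated es in u ∷ us , (e , s) ∷ ps

    rotated-unique : ∀ {ws us} → Pointwise Rotated ws us → AllPairs (λ w w′ → ¬ w ↻ w′) ws →
      Unique us
    rotated-unique []              []       = []
    rotated-unique ((_ , s) ∷ ps) (d ∷ ds) = head ps d ∷ rotated-unique ps ds
      where
      head : ∀ {ws us} → Pointwise Rotated ws us → All (λ w′ → ¬ _ ↻ w′) ws → All (_ ≢_) us
      head []              []          = []
      head ((_ , s′) ∷ ps) (¬r ∷ ¬rs) = (λ where ≡.refl → ¬r (s ◅◅ ↻-sym s′)) ∷ head ps ¬rs

    rotated-sound : ∀ {ws us u} → Pointwise Rotated ws us → u ∈ us → IsToricTotalExtension Q (v ∷ u)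
    rotated-sound ((e , s) ∷ _) (here ≡.refl) = extension-↻ e s
    rotated-sound (_ ∷ ps)      (there u∈)    = rotated-sound ps u∈

    -- The tail `u` itself is found, not merely a rotation of it, because the leading `v` fixes the
    -- rotation.
    rotated-complete : ∀ {ws us u} → Pointwise Rotated ws us → Unique (v ∷ u) →
      Any (v ∷ u ↻_) ws → u ∈ us
    rotated-complete ((_ , s) ∷ _) uniq (here r)  = here (↻-tail-unique uniq (r ◅◅ s))
    rotated-complete (_ ∷ ps)      uniq (there r) = there (rotated-complete ps uniq r)

  module _ (sep : Separation (Edge Q) (_≢ v)) where
    open Separation sep
    open CommutativeRing (ℚ⟨x⟩ n)
    open Sums (ℚ⟨x⟩ n)
    open SetoidReasoning setoid

    private
      us = proj₁ (rotated (sound ℒ))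
      ps = proj₂ (rotated (sound ℒ))

      -- An edge either meets `v`, which comes first in both words, or joins two vertices of the
      -- same side, whose relative order the filters determine. Hence both words induce the same
      -- orientation.
      shuffle-closed : ∀ {u u′} → IsToricTotalExtension Q (v ∷ u) →
        filters side? u′ ≡ filters side? u → IsToricTotalExtension Q (v ∷ u′)
      shuffle-closed {u} {u′} ext eq = ∼orient⇒extension
        (↭-trans (prep v (filters-↭ side? eq)) (proj₁ ext))
        (∼-trans (extension⇒∼orient ext) (done λ i j →
          mk⇔ (λ (e , lt) → e , to (same e) lt) (λ (e , lt) → e , from (same e) lt)))
        where
        same : ∀ {i j} → Edge Q i j →
          position (v ∷ u) i < position (v ∷ u) j ⇔ position (v ∷ u′) i < position (v ∷ u′) j
        same {i} {j} e with v Fin.≟ i | v Fin.≟ j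
        ... | yes _   | yes _   = ⇔.refl
        ... | yes _   | no  _   = mk⇔ (λ _ → z<s) (λ _ → z<s)
        ... | no  _   | yes _   = mk⇔ (λ ()) (λ ())
        ... | no  v≢i | no  v≢j = mk⇔ (s<s ∘ to ih ∘ s<s⁻¹) (s<s ∘ from ih ∘ s<s⁻¹)
          where ih = filters-position side? {u} {u′} eq (separated (v≢i ∘ ≡.sym) (v≢j ∘ ≡.sym) e)

      ∈-tail : ∀ {u i} → IsTotalOrder (v ∷ u) → i ≢ v → i ∈ u
      ∈-tail {i = i} t i≢v with ∈-total t i
      ... | here i≡v  = contradiction i≡v i≢v
      ... | there i∈u = i∈u

      2≤length : ∀ {w : List (Fin n)} → a ∈ w → v ∈ w → 2 ≤ length w
      2≤length {_ ∷ _ ∷ _} _            _             = s≤s (s≤s z≤n)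
      2≤length {_ ∷ []}    (here ≡.refl) (here ≡.refl) = contradiction ≡.refl a∈S

      Ψ-rotated : ∀ {ws us} → Pointwise Rotated ws us →
        sum Ψ-order ws ≈ sum (λ u → cycle (v ∷ u)) us
      Ψ-rotated []                        = refl
      Ψ-rotated (((w↭V , _) , s) ∷ ps) = +-cong
        (trans (Ψ-order≈cycle (unique-total w↭V)
                              (2≤length (∈-total w↭V a) (∈-total w↭V v))) (cycle-↻ s))
        (Ψ-rotated ps)

    Ψ-tor-separation : Ψ-tor ℒ ≈ 0#
    Ψ-tor-separation = begin
      Ψ-tor ℒ                           ≈⟨ Ψ-rotated ps ⟩
      sum (λ u → cycle (v ∷ u)) us
        -- Group the tails by their pair of filters. Each group consists of all shuffles of its two
        -- sides, and its sum is zero by `sum-fibre`.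
        ≈⟨ sum-fibres (λ u → cycle (v ∷ u))
             (≡-dec (List.≡-dec Fin._≟_) (List.≡-dec Fin._≟_)) (filters side?)
             (λ u → shuffles (filter side? u) (filter (∁? side?) u))
             (λ {u} u∈ →
               let all  = All.all-filter side? u
                   none = All.all-filter (∁? side?) u
                   t    = proj₁ (rotated-sound ps u∈)
               in (shuffles-unique side? all none , λ {u′} → mk⇔
                     (λ u′∈ → let e , f = filter-shuffle side? all none u′∈ in ≡.cong₂ _,_ e f)
                     (λ eq → ≡.subst (λ (is , js) → u′ ∈ shuffles is js) eq
                                     (∈-shuffles-filter side? u′))) ,
                  sum-fibre side? (unique-total t) (∈-tail t a∈S) (∈-tail t b∈S) a∈Side b∉Side)
             (rotated-unique ps (distinct ℒ))
             -- Reshuffling gives another extension, so `complete` finds its class in `ℒ`, and its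
             -- tail is then one of the tails being summed.
             (λ u∈ eq → let ext = shuffle-closed (rotated-sound ps u∈) eq in
               rotated-complete ps (unique-total (proj₁ ext)) (complete ℒ ext)) ⟩
      0#                                ∎

theorem1p5 : ∀ {n : ℕ} (Q : Quiver n) →
    (¬ Connected (Edge Q) × 3 ≤ n) ⊎ (∃ λ v → IsCutVertex (Edge Q) v) →
    (ℒ : ℒ-tor Q) →
    let open CommutativeRing (ℚ⟨x⟩ n) in
    Ψ-tor ℒ ≈ 0#
theorem1p5 {n} Q (inj₁ (¬conn , 3≤n)) ℒ = ≃0-stable (ℚ[x] n) (Ψ-tor ℒ) λ Ψ≄0 →
  -- An enumeration of the components is available only under double negation, which suffices
  -- because vanishing is stable.
  ¬¬-transversal ε (allFin n) (λ {i} _ → ∈-allFin i) λ (C : Components (Edge Q) U) →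
    let v , sep = disconnected-separation (Edge-sym Q) 3≤n ¬conn C
    in Ψ≄0 (Ψ-tor-separation Q v ℒ sep)
theorem1p5 Q (inj₂ (v , cut)) ℒ = Ψ-tor-separation Q v ℒ (cut-separation (Edge-sym Q) cut)
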